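{- Let $n$ be an odd positive integer such that $D=n^2+1$ is squarefree. Then $h(D)>1$ if and only if $n>1$.
   Context: For a squarefree integer $D>1$, $h(D)$ denotes the class number of the real quadratic field $\mathbb{Q}(\sqrt D)$. -}

module Defs where

open import Data.Fin.Base using (Fin)
open import Data.Integer.Base using (ℤ; +_)
open import Data.List.Base using (List; []; _∷_)
open import Data.Nat.Base as ℕ using (ℕ)
open import Data.Nat.Divisibility using (_∣_)
open import Data.Product.Base using (Σ-syntax; ∃-syntax; _×_)
open import Data.Rational.Base as ℚ using (ℚ; 0ℚ; 1ℚ)
open import Function.Definitions using (Congruent; Bijective)
open import Level using (0ℓ)
open import Relation.Binary.PropositionalEquality.Core using (_≡_; _≢_)
open import Relation.Unary using (Pred; _∈_; _⊆_; _≐_)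

Squarefree : ℕ → Set
Squarefree m = ∀ d → d ℕ.* d ∣ m → d ≡ 1

-- ℚ(√D) as ℚ[X]/(X² − D): the element  a +√ b  is a + b√D.
-- This is a field exactly when D is not a perfect square.

infix 5 _+√_

record ℚ√ (D : ℕ) : Set where
  constructor _+√_
  field
    rat irr : ℚ

fromℤ : ℤ → ℚ
fromℤ z = z ℚ./ 1

module QuadraticField (D : ℕ) where

  K : Set
  K = ℚ√ D

  infixl 6 _+_
  infixl 7 _*_ _·_

  _+_ : K → K → K
  (a +√ b) + (c +√ d) = a ℚ.+ c +√ b ℚ.+ d

  _*_ : K → K → K
  (a +√ b) * (c +√ d) =
    a ℚ.* c ℚ.+ fromℤ (+ D) ℚ.* (b ℚ.* d) +√ a ℚ.* d ℚ.+ b ℚ.* c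

  0# 1# : K
  0# = 0ℚ +√ 0ℚ
  1# = 1ℚ +√ 0ℚ

  ι : ℤ → K
  ι z = fromℤ z +√ 0ℚ

  -- For cs = c₀ ∷ … ∷ c₍ₘ₋₁₎ ∷ [] this is c₀ + c₁ x + … + c₍ₘ₋₁₎ xᵐ⁻¹ + xᵐ
  -- (Horner's scheme, with an implicit leading coefficient 1).
  evalMonic : List ℤ → K → K
  evalMonic []       x = 1#
  evalMonic (c ∷ cs) x = ι c + x * evalMonic cs x

  -- The ring of integers: the elements of K that are integral over ℤ.
  𝓞 : Pred K 0ℓ
  𝓞 x = ∃[ cs ] evalMonic cs x ≡ 0#

  -- The 𝓞-linear combinations of a finite list of elements.
  Span : List K → Pred K 0ℓ
  Span []       x = x ≡ 0#
  Span (g ∷ gs) x = ∃[ r ] ∃[ y ] r ∈ 𝓞 × y ∈ Span gs × x ≡ r * g + y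

  -- Every ideal of 𝓞 is finitely generated because 𝓞 is Noetherian.  That is
  -- not available constructively for arbitrary predicates, so the generators
  -- are required explicitly.
  record NonzeroIdeal : Set₁ where
    field
      Member            : Pred K 0ℓ
      integral          : Member ⊆ 𝓞
      0∈                : 0# ∈ Member
      +-closed          : ∀ {x y} → x ∈ Member → y ∈ Member → x + y ∈ Member
      *-closed          : ∀ {r x} → r ∈ 𝓞 → x ∈ Member → r * x ∈ Member
      finitelyGenerated : ∃[ gs ] Member ≐ Span gs
      nonzero           : ∃[ x ] x ∈ Member × x ≢ 0#

  open NonzeroIdeal using (Member)

  -- For an ideal I of 𝓞 and α in 𝓞 this is the product of ideals (α) I.
  _·_ : K → Pred K 0ℓ → Pred K 0ℓ
  (α · I) y = ∃[ x ] x ∈ I × y ≡ α * x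

  infix 4 _~_

  -- I and J lie in the same ideal class.
  _~_ : NonzeroIdeal → NonzeroIdeal → Set
  I ~ J = ∃[ α ] ∃[ β ] α ∈ 𝓞 × α ≢ 0# × β ∈ 𝓞 × β ≢ 0#
            × (α · Member I) ≐ (β · Member J)

open QuadraticField using (NonzeroIdeal; _~_)

-- "h is the class number of ℚ(√D)": there are exactly h ideal classes.  The
-- quotient by _~_ is expressed by asking for a bijection of the setoid
-- (NonzeroIdeal D , _~_) with Fin h; this determines h uniquely.
IsClassNumber : ℕ → ℕ → Set₁
IsClassNumber D h =
  Σ[ class ∈ (NonzeroIdeal D → Fin h) ]
    Congruent (_~_ D) _≡_ class × Bijective (_~_ D) _≡_ class

{-# OPTIONS --safe #-}

-- If x is integral, then the powers of x and of x + 1 have bounded denominators, so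
-- the norms of x and x + 1 are integers.  Since n is odd, D = n² + 1 ≡ 2 (mod 4), and
-- it follows that the ring of integers is ℤ[√D].
-- For n = 1 this is ℤ[√2], which is norm-Euclidean.  For n > 1 the prime ideal
-- (2, √D) is not principal: a generator would have norm ±2, but a² − Db² = ±2 has
-- no solution, by descent along the unit n + √D down to |b| ≤ 1.

module Submission where

open import Defs

open import Algebra.Bundles using (CommutativeRing)
import Algebra.Solver.Ring as RingSolver
open import Algebra.Solver.Ring.AlmostCommutativeRing using (fromCommutativeRing; _-Raw-AlmostCommutative⟶_)
open import Data.Fin.Base using (Fin; zero; suc)
open import Data.Integer.Base as ℤ using (ℤ; +_; -[1+_]; ∣_∣)
open import Data.Integer.DivMod using (_/ℕ_; _%ℕ_; n%ℕd<d; a≡a%ℕn+[a/ℕn]*n)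
import Data.Integer.Properties as ℤ
import Data.Integer.Solver
open import Data.List.Base using (List; []; _∷_)
open import Data.Maybe.Base as Maybe using (Maybe)
open import Data.Nat.Base as ℕ using (ℕ; zero; suc; s≤s; z≤n)
open import Data.Nat.Coprimality using (Coprime; coprime-divisor; 1-coprimeTo; recompute) renaming (sym to coprime-sym)
open import Data.Nat.Divisibility using (_∣_; divides; ∣-trans; ∣⇒≤; m%n≡0⇒n∣m)
open import Data.Nat.DivMod using (_/_; _%_; m≡m%n+[m/n]*n; m%n<n)
open import Data.Nat.Induction using (<-rec)
import Data.Nat.Properties as ℕ
import Data.Nat.Solver
open import Data.Product.Base using (∃-syntax; _×_; _,_; proj₁; proj₂)
open import Data.Rational.Base as ℚ using (ℚ; mkℚ; 0ℚ; 1ℚ; ½; ↥_; ↧_; ↧ₙ_)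
import Data.Rational.Literals as normalised
import Data.Rational.Properties as ℚ
import Data.Rational.Solver
open import Data.Rational.Unnormalised.Base using (mkℚᵘ; *≡*)
open import Data.Sum.Base using (_⊎_; inj₁; inj₂)
open import Function.Base using (id)
open import Level using (0ℓ)
open import Relation.Binary.Definitions using (DecidableEquality)
open import Relation.Binary.PropositionalEquality using (_≡_; _≢_; refl; sym; trans; cong; cong₂; subst; subst₂; isEquivalence; module ≡-Reasoning)
open import Relation.Nullary.Decidable.Core using (yes; no; map′; _×-dec_; dec⇒maybe; decidable-stable)
open import Relation.Nullary.Negation.Core using (¬_; contradiction)
open import Relation.Unary using (Pred; _∈_; _⊆_)
open import Algebra.Properties.Group ℚ.+-0-group using (inverseˡ-unique)

-- An element of `𝓞` comes with an arbitrary monic polynomial, which need not be its minimal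
-- polynomial, so norm and trace cannot be read off the coefficients. The norm is multiplicative and
-- therefore passes to all powers at once; the trace is not, and is recovered as N(x + 1) - N(x) -
-- 1.
--
-- The unit n + √D has norm -1, so each descent step exchanges the equations with right sides 2 and
-- -2, and the induction has to carry both. The hypothesis n > 1 enters at the bottom: D + 2 and D -
-- 2 then lie strictly between consecutive squares, while for n = 1 they are the squares 4 and 0.
--
-- For n = 1 the ideals are arbitrary predicates, and any two of them are shown equivalent only up
-- to double negation. This suffices because the conclusion drawn there is the negative statement
-- that 1 < h fails.

module ℕ-Solver = Data.Nat.Solver.+-*-Solver
module ℤ-Solver = Data.Integer.Solver.+-*-Solver
module ℚ-Solver = Data.Rational.Solver.+-*-Solver

-- Integers in ℚ and bounded denominators

-- `z / 1` is normalised by a gcd and is stuck for a variable `z`; after rewriting to the literal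
-- fraction, numerators, sums and products compute.
fromℤ≡mkℚ : ∀ z → fromℤ z ≡ normalised.fromℤ z
fromℤ≡mkℚ z = ℚ.fromℚᵘ-toℚᵘ (normalised.fromℤ z)

fromℤ-+ : ∀ a b → fromℤ (a ℤ.+ b) ≡ fromℤ a ℚ.+ fromℤ b
fromℤ-+ a b rewrite fromℤ≡mkℚ a | fromℤ≡mkℚ b =
  cong fromℤ (cong₂ ℤ._+_ (sym (ℤ.*-identityʳ a)) (sym (ℤ.*-identityʳ b)))

fromℤ-* : ∀ a b → fromℤ (a ℤ.* b) ≡ fromℤ a ℚ.* fromℤ b
fromℤ-* a b rewrite fromℤ≡mkℚ a | fromℤ≡mkℚ b = refl

fromℤ-neg : ∀ a → fromℤ (ℤ.- a) ≡ ℚ.- fromℤ a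
fromℤ-neg a = inverseˡ-unique (fromℤ (ℤ.- a)) (fromℤ a)
  (trans (sym (fromℤ-+ (ℤ.- a) a)) (cong fromℤ (ℤ.+-inverseˡ a)))

fromℤ-injective : ∀ a b → fromℤ a ≡ fromℤ b → a ≡ b
fromℤ-injective a b eq =
  cong ↥_ (trans (sym (fromℤ≡mkℚ a)) (trans eq (fromℤ≡mkℚ b)))

*-denominator : ∀ r → r ℚ.* fromℤ (↧ r) ≡ fromℤ (↥ r)
*-denominator r@record{} rewrite fromℤ≡mkℚ (↧ r) =
  trans (ℚ.fromℚᵘ-cong {mkℚᵘ (↥ r ℤ.* ↧ r) (ℕ.pred (↧ₙ r ℕ.* 1))} {mkℚᵘ (↥ r) 0}
    (*≡* (trans (ℤ.*-identityʳ _) (cong (λ d → ↥ r ℤ.* + d) (sym (ℕ.*-identityʳ (↧ₙ r))))))) refl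

coprime-* : ∀ {a b c} → Coprime a c → Coprime b c → Coprime (a ℕ.* b) c
coprime-* {a} {b} {c} ac bc {d} (d∣ab , d∣c) =
  bc (coprime-divisor (λ (e∣d , e∣a) → ac (e∣a , ∣-trans e∣d d∣c)) d∣ab , d∣c)

coprime-^ : ∀ {a c} k → Coprime a c → Coprime (a ℕ.^ k) c
coprime-^ {c = c} zero ac = 1-coprimeTo c
coprime-^ (suc k) ac = coprime-* ac (coprime-^ k ac)

n<m^n : ∀ {m} → 1 ℕ.< m → ∀ n → n ℕ.< m ℕ.^ n
n<m^n 1<m zero = ℕ.s≤s ℕ.z≤n
n<m^n {m} 1<m (suc n) = begin-strict
  suc n              ≤⟨ n<m^n 1<m n ⟩
  m ℕ.^ n            <⟨ ℕ.m<m*n (m ℕ.^ n) m {{ℕ.>-nonZero (ℕ.≤-<-trans ℕ.z≤n (n<m^n 1<m n))}} 1<m ⟩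
  m ℕ.^ n ℕ.* m      ≡⟨ ℕ.*-comm (m ℕ.^ n) m ⟩
  m ℕ.* m ℕ.^ n      ∎
  where open ℕ.≤-Reasoning

infixr 8 _^ℚ_
_^ℚ_ : ℚ → ℕ → ℚ
r ^ℚ zero = 1ℚ
r ^ℚ suc k = r ℚ.* r ^ℚ k

^ℚ-denominator : ∀ r k → r ^ℚ k ℚ.* fromℤ (+ (↧ₙ r ℕ.^ k)) ≡ fromℤ (↥ r ℤ.^ k)
^ℚ-denominator r zero = refl
^ℚ-denominator r (suc k) = begin
  (r ℚ.* r ^ℚ k) ℚ.* fromℤ (+ (↧ₙ r ℕ.* ↧ₙ r ℕ.^ k))
    ≡⟨ cong (λ z → (r ℚ.* r ^ℚ k) ℚ.* fromℤ z) (ℤ.pos-* (↧ₙ r) (↧ₙ r ℕ.^ k)) ⟩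
  (r ℚ.* r ^ℚ k) ℚ.* fromℤ (↧ r ℤ.* + (↧ₙ r ℕ.^ k))
    ≡⟨ cong ((r ℚ.* r ^ℚ k) ℚ.*_) (fromℤ-* (↧ r) (+ (↧ₙ r ℕ.^ k))) ⟩
  (r ℚ.* r ^ℚ k) ℚ.* (fromℤ (↧ r) ℚ.* fromℤ (+ (↧ₙ r ℕ.^ k)))
    ≡⟨ solve 4 (λ r s q t → (r :* s) :* (q :* t) := (r :* q) :* (s :* t)) refl
         r (r ^ℚ k) (fromℤ (↧ r)) (fromℤ (+ (↧ₙ r ℕ.^ k))) ⟩
  (r ℚ.* fromℤ (↧ r)) ℚ.* (r ^ℚ k ℚ.* fromℤ (+ (↧ₙ r ℕ.^ k)))
    ≡⟨ cong₂ ℚ._*_ (*-denominator r) (^ℚ-denominator r k) ⟩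
  fromℤ (↥ r) ℚ.* fromℤ (↥ r ℤ.^ k)
    ≡⟨ sym (fromℤ-* (↥ r) (↥ r ℤ.^ k)) ⟩
  fromℤ (↥ r ℤ.^ suc k) ∎
  where
  open ≡-Reasoning
  open ℚ-Solver

abs-^ : ∀ z k → ∣ z ℤ.^ k ∣ ≡ ∣ z ∣ ℕ.^ k
abs-^ z zero = refl
abs-^ z (suc k) = trans (ℤ.abs-* z (z ℤ.^ k)) (cong (∣ z ∣ ℕ.*_) (abs-^ z k))

IsInteger : ℚ → Set
IsInteger r = ∃[ z ] r ≡ fromℤ z

denominator-1⇒integer : ∀ r → ↧ₙ r ≡ 1 → IsInteger r
denominator-1⇒integer r q≡1 = ↥ r , (begin
  r                    ≡⟨ sym (ℚ.*-identityʳ r) ⟩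
  r ℚ.* fromℤ (+ 1)    ≡⟨ cong (λ d → r ℚ.* fromℤ (+ d)) (sym q≡1) ⟩
  r ℚ.* fromℤ (↧ r)    ≡⟨ *-denominator r ⟩
  fromℤ (↥ r)          ∎)
  where open ≡-Reasoning

numerator⊥denominator : ∀ r → Coprime ∣ ↥ r ∣ (↧ₙ r)
numerator⊥denominator (mkℚ p q c) = recompute c

-- Write r = p/q in lowest terms. Integrality of d rᵏ makes qᵏ divide d pᵏ, hence d, for every k. If
-- q ≥ 2, the exponent k = |d| gives a divisor of d ≠ 0 larger than |d|.
bounded-denominators⇒integer : ∀ d r → d ≢ ℤ.0ℤ →
  (∀ k → IsInteger (fromℤ d ℚ.* r ^ℚ k)) → IsInteger r
bounded-denominators⇒integer d r d≢0 int = denominator-1⇒integer r q≡1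
  where
  q^k∣d : ∀ k → ↧ₙ r ℕ.^ k ∣ ∣ d ∣
  q^k∣d k with int k
  ... | e , eq = coprime-divisor
    (coprime-^ k (coprime-sym (coprime-^ k (numerator⊥denominator r))))
    (divides ∣ e ∣ (begin
      ∣ ↥ r ∣ ℕ.^ k ℕ.* ∣ d ∣                  ≡⟨ ℕ.*-comm (∣ ↥ r ∣ ℕ.^ k) ∣ d ∣ ⟩
      ∣ d ∣ ℕ.* ∣ ↥ r ∣ ℕ.^ k                  ≡⟨ cong (∣ d ∣ ℕ.*_) (sym (abs-^ (↥ r) k)) ⟩
      ∣ d ∣ ℕ.* ∣ ↥ r ℤ.^ k ∣                  ≡⟨ sym (ℤ.abs-* d (↥ r ℤ.^ k)) ⟩
      ∣ d ℤ.* ↥ r ℤ.^ k ∣                      ≡⟨ cong ∣_∣ (sym (fromℤ-injective (e ℤ.* + (↧ₙ r ℕ.^ k)) (d ℤ.* ↥ r ℤ.^ k) clear)) ⟩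
      ∣ e ℤ.* + (↧ₙ r ℕ.^ k) ∣                 ≡⟨ ℤ.abs-* e (+ (↧ₙ r ℕ.^ k)) ⟩
      ∣ e ∣ ℕ.* ↧ₙ r ℕ.^ k                     ∎))
    where
    open ≡-Reasoning
    Q = fromℤ (+ (↧ₙ r ℕ.^ k))
    clear : fromℤ (e ℤ.* + (↧ₙ r ℕ.^ k)) ≡ fromℤ (d ℤ.* ↥ r ℤ.^ k)
    clear = begin
      fromℤ (e ℤ.* + (↧ₙ r ℕ.^ k))        ≡⟨ fromℤ-* e _ ⟩
      fromℤ e ℚ.* Q                       ≡⟨ cong (ℚ._* Q) (sym eq) ⟩
      fromℤ d ℚ.* r ^ℚ k ℚ.* Q            ≡⟨ ℚ.*-assoc (fromℤ d) (r ^ℚ k) Q ⟩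
      fromℤ d ℚ.* (r ^ℚ k ℚ.* Q)          ≡⟨ cong (fromℤ d ℚ.*_) (^ℚ-denominator r k) ⟩
      fromℤ d ℚ.* fromℤ (↥ r ℤ.^ k)       ≡⟨ sym (fromℤ-* d (↥ r ℤ.^ k)) ⟩
      fromℤ (d ℤ.* ↥ r ℤ.^ k)             ∎

  q≡1 : ↧ₙ r ≡ 1
  q≡1 with ↧ₙ r ℕ.≤? 1
  ... | yes q≤1 = ℕ.≤-antisym q≤1 (ℕ.s≤s ℕ.z≤n)
  ... | no q≰1 = contradiction
    (∣⇒≤ {{ℕ.≢-nonZero (λ ∣d∣≡0 → d≢0 (ℤ.∣i∣≡0⇒i≡0 ∣d∣≡0))}} (q^k∣d ∣ d ∣))
    (ℕ.<⇒≱ (n<m^n (ℕ.≰⇒> q≰1) ∣ d ∣))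

*-≢0 : ∀ i j → i ≢ ℤ.0ℤ → j ≢ ℤ.0ℤ → i ℤ.* j ≢ ℤ.0ℤ
*-≢0 i j i≢0 j≢0 ij≡0 with ℤ.i*j≡0⇒i≡0∨j≡0 i {j} ij≡0
... | inj₁ i≡0 = i≢0 i≡0
... | inj₂ j≡0 = j≢0 j≡0

-- The ring structure of `K`, the order ℤ[√D] and the norm

module QuadraticRing (D : ℕ) where
  open QuadraticField D
  open ≡-Reasoning

  δ : ℚ
  δ = fromℤ (+ D)

  -K_ : K → K
  -K (a +√ b) = ℚ.- a +√ ℚ.- b

  module K-Laws where
    open ℚ-Solver

    *-assoc : ∀ x y z → (x * y) * z ≡ x * (y * z)
    *-assoc (a +√ b) (c +√ d) (e +√ f) = cong₂ _+√_
      (solve 7 (λ δ a b c d e f →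
         (a :* c :+ δ :* (b :* d)) :* e :+ δ :* ((a :* d :+ b :* c) :* f) :=
         a :* (c :* e :+ δ :* (d :* f)) :+ δ :* (b :* (c :* f :+ d :* e))) refl δ a b c d e f)
      (solve 7 (λ δ a b c d e f →
         (a :* c :+ δ :* (b :* d)) :* f :+ (a :* d :+ b :* c) :* e :=
         a :* (c :* f :+ d :* e) :+ b :* (c :* e :+ δ :* (d :* f))) refl δ a b c d e f)

    *-comm : ∀ x y → x * y ≡ y * x
    *-comm (a +√ b) (c +√ d) = cong₂ _+√_
      (solve 5 (λ δ a b c d → a :* c :+ δ :* (b :* d) := c :* a :+ δ :* (d :* b)) refl δ a b c d)
      (solve 4 (λ a b c d → a :* d :+ b :* c := c :* b :+ d :* a) refl a b c d)

    *-identityˡ : ∀ x → 1# * x ≡ x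
    *-identityˡ (a +√ b) = cong₂ _+√_
      (solve 3 (λ δ a b → con 1ℚ :* a :+ δ :* (con 0ℚ :* b) := a) refl δ a b)
      (solve 2 (λ a b → con 1ℚ :* b :+ con 0ℚ :* a := b) refl a b)

    *-distribˡ-+ : ∀ x y z → x * (y + z) ≡ x * y + x * z
    *-distribˡ-+ (a +√ b) (c +√ d) (e +√ f) = cong₂ _+√_
      (solve 7 (λ δ a b c d e f →
         a :* (c :+ e) :+ δ :* (b :* (d :+ f)) :=
         (a :* c :+ δ :* (b :* d)) :+ (a :* e :+ δ :* (b :* f))) refl δ a b c d e f)
      (solve 6 (λ a b c d e f →
         a :* (d :+ f) :+ b :* (c :+ e) := (a :* d :+ b :* c) :+ (a :* f :+ b :* e))
         refl a b c d e f)

  open K-Laws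

  K-commutativeRing : CommutativeRing 0ℓ 0ℓ
  K-commutativeRing = record
    { Carrier = K ; _≈_ = _≡_ ; _+_ = _+_ ; _*_ = _*_ ; -_ = -K_ ; 0# = 0# ; 1# = 1#
    ; isCommutativeRing = record
      { isRing = record
        { +-isAbelianGroup = record
          { isGroup = record
            { isMonoid = record
              { isSemigroup = record
                { isMagma = record { isEquivalence = isEquivalence ; ∙-cong = cong₂ _+_ }
                ; assoc = λ { (a +√ b) (c +√ d) (e +√ f) →
                    cong₂ _+√_ (ℚ.+-assoc a c e) (ℚ.+-assoc b d f) }
                }
              ; identity =
                  (λ { (a +√ b) → cong₂ _+√_ (ℚ.+-identityˡ a) (ℚ.+-identityˡ b) })
                , (λ { (a +√ b) → cong₂ _+√_ (ℚ.+-identityʳ a) (ℚ.+-identityʳ b) })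
              }
            ; inverse =
                (λ { (a +√ b) → cong₂ _+√_ (ℚ.+-inverseˡ a) (ℚ.+-inverseˡ b) })
              , (λ { (a +√ b) → cong₂ _+√_ (ℚ.+-inverseʳ a) (ℚ.+-inverseʳ b) })
            ; ⁻¹-cong = cong -K_
            }
          ; comm = λ { (a +√ b) (c +√ d) → cong₂ _+√_ (ℚ.+-comm a c) (ℚ.+-comm b d) }
          }
        ; *-cong = cong₂ _*_
        ; *-assoc = *-assoc
        ; *-identity = *-identityˡ , λ x → trans (*-comm x 1#) (*-identityˡ x)
        ; distrib = *-distribˡ-+ , λ x y z → trans (*-comm (y + z) x)
            (trans (*-distribˡ-+ x y z) (cong₂ _+_ (*-comm x y) (*-comm x z)))
        }
      ; *-comm = *-comm
      }
    }

  ι-+ : ∀ a b → ι (a ℤ.+ b) ≡ ι a + ι b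
  ι-+ a b = cong (_+√ 0ℚ) (fromℤ-+ a b)

  ι-* : ∀ a b → ι (a ℤ.* b) ≡ ι a * ι b
  ι-* a b = cong₂ _+√_
    (trans (fromℤ-* a b) (solve 3 (λ δ a b → a :* b := a :* b :+ δ :* (con 0ℚ :* con 0ℚ)) refl δ (fromℤ a) (fromℤ b)))
    (solve 2 (λ a b → con 0ℚ := a :* con 0ℚ :+ con 0ℚ :* b) refl (fromℤ a) (fromℤ b))
    where open ℚ-Solver

  ι-neg : ∀ a → ι (ℤ.- a) ≡ -K ι a
  ι-neg a = cong (_+√ 0ℚ) (fromℤ-neg a)

  ι-morphism : CommutativeRing.rawRing ℤ.+-*-commutativeRing
                 -Raw-AlmostCommutative⟶ fromCommutativeRing K-commutativeRing
  ι-morphism = record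
    { ⟦_⟧ = ι ; +-homo = ι-+ ; *-homo = ι-* ; -‿homo = ι-neg ; 0-homo = refl ; 1-homo = refl }

  ι-≟ : ∀ a b → Maybe (ι a ≡ ι b)
  ι-≟ a b = Maybe.map (cong ι) (dec⇒maybe (a ℤ.≟ b))

  -- Coefficients are taken in ℤ because closed terms of K do not reduce to
  -- normal forms while D is a variable.
  module K-Solver = RingSolver
    (CommutativeRing.rawRing ℤ.+-*-commutativeRing) (fromCommutativeRing K-commutativeRing) ι-morphism ι-≟

  _≟K_ : DecidableEquality K
  (a +√ b) ≟K (c +√ d) =
    map′ (λ { (refl , refl) → refl }) (λ { refl → refl , refl }) ((a ℚ.≟ c) ×-dec (b ℚ.≟ d))

  embed : ℤ → ℤ → K
  embed a b = fromℤ a +√ fromℤ b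

  -- The order ℤ[√D].
  𝓛 : Pred K 0ℓ
  𝓛 x = ∃[ a ] ∃[ b ] x ≡ embed a b

  embed-+ : ∀ a b c d → embed a b + embed c d ≡ embed (a ℤ.+ c) (b ℤ.+ d)
  embed-+ a b c d = cong₂ _+√_ (sym (fromℤ-+ a c)) (sym (fromℤ-+ b d))

  embed-* : ∀ a b c d →
    embed a b * embed c d ≡ embed (a ℤ.* c ℤ.+ + D ℤ.* (b ℤ.* d)) (a ℤ.* d ℤ.+ b ℤ.* c)
  embed-* a b c d = sym (cong₂ _+√_
    (begin
      fromℤ (a ℤ.* c ℤ.+ + D ℤ.* (b ℤ.* d))                 ≡⟨ fromℤ-+ (a ℤ.* c) (+ D ℤ.* (b ℤ.* d)) ⟩
      fromℤ (a ℤ.* c) ℚ.+ fromℤ (+ D ℤ.* (b ℤ.* d))         ≡⟨ cong₂ ℚ._+_ (fromℤ-* a c)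
                                                              (trans (fromℤ-* (+ D) (b ℤ.* d)) (cong (δ ℚ.*_) (fromℤ-* b d))) ⟩
      fromℤ a ℚ.* fromℤ c ℚ.+ δ ℚ.* (fromℤ b ℚ.* fromℤ d)   ∎)
    (trans (fromℤ-+ (a ℤ.* d) (b ℤ.* c)) (cong₂ ℚ._+_ (fromℤ-* a d) (fromℤ-* b c))))

  embed-injective : ∀ a b c d → embed a b ≡ embed c d → a ≡ c × b ≡ d
  embed-injective a b c d eq =
    fromℤ-injective a c (cong ℚ√.rat eq) , fromℤ-injective b d (cong ℚ√.irr eq)

  𝓛-+ : ∀ {x y} → x ∈ 𝓛 → y ∈ 𝓛 → x + y ∈ 𝓛
  𝓛-+ (a , b , refl) (c , d , refl) = a ℤ.+ c , b ℤ.+ d , embed-+ a b c d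

  𝓛-* : ∀ {x y} → x ∈ 𝓛 → y ∈ 𝓛 → x * y ∈ 𝓛
  𝓛-* (a , b , refl) (c , d , refl) =
    a ℤ.* c ℤ.+ + D ℤ.* (b ℤ.* d) , a ℤ.* d ℤ.+ b ℤ.* c , embed-* a b c d

  ι∈𝓛 : ∀ z → ι z ∈ 𝓛
  ι∈𝓛 z = z , ℤ.0ℤ , refl

  norm : K → ℚ
  norm (a +√ b) = a ℚ.* a ℚ.+ ℚ.- (δ ℚ.* (b ℚ.* b))

  norm-* : ∀ x y → norm (x * y) ≡ norm x ℚ.* norm y
  norm-* (a +√ b) (c +√ d) = solve 5 (λ δ a b c d →
    (a :* c :+ δ :* (b :* d)) :* (a :* c :+ δ :* (b :* d))
      :+ (:- (δ :* ((a :* d :+ b :* c) :* (a :* d :+ b :* c)))) :=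
    (a :* a :+ (:- (δ :* (b :* b)))) :* (c :* c :+ (:- (δ :* (d :* d))))) refl δ a b c d
    where open ℚ-Solver

  normℤ : ℤ → ℤ → ℤ
  normℤ a b = a ℤ.* a ℤ.- + D ℤ.* (b ℤ.* b)

  norm-embed : ∀ a b → norm (embed a b) ≡ fromℤ (normℤ a b)
  norm-embed a b = sym (begin
    fromℤ (a ℤ.* a ℤ.- + D ℤ.* (b ℤ.* b))
      ≡⟨ fromℤ-+ (a ℤ.* a) (ℤ.- (+ D ℤ.* (b ℤ.* b))) ⟩
    fromℤ (a ℤ.* a) ℚ.+ fromℤ (ℤ.- (+ D ℤ.* (b ℤ.* b)))
      ≡⟨ cong₂ ℚ._+_ (fromℤ-* a a) (trans (fromℤ-neg (+ D ℤ.* (b ℤ.* b)))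
           (cong ℚ.-_ (trans (fromℤ-* (+ D) (b ℤ.* b)) (cong (δ ℚ.*_) (fromℤ-* b b))))) ⟩
    norm (embed a b) ∎)

  norm-ι : ∀ d → norm (ι d) ≡ fromℤ (d ℤ.* d)
  norm-ι d = trans (solve 2 (λ δ d → d :* d :+ (:- (δ :* (con 0ℚ :* con 0ℚ))) := d :* d) refl δ (fromℤ d))
                   (sym (fromℤ-* d d))
    where open ℚ-Solver

  𝓛⇒integer-norm : ∀ {x} → x ∈ 𝓛 → IsInteger (norm x)
  𝓛⇒integer-norm (a , b , refl) = normℤ a b , norm-embed a b

  common-denominator : ∀ x → ∃[ d ] d ≢ ℤ.0ℤ × ι d * x ∈ 𝓛
  common-denominator (a +√ b) =
    ↧ a ℤ.* ↧ b , *-≢0 (↧ a) (↧ b) (λ ()) (λ ()) , ↥ a ℤ.* ↧ b , ↥ b ℤ.* ↧ a , cong₂ _+√_ rat-eq irr-eq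
    where
    open ℚ-Solver
    rat-eq : fromℤ (↧ a ℤ.* ↧ b) ℚ.* a ℚ.+ δ ℚ.* (0ℚ ℚ.* b) ≡ fromℤ (↥ a ℤ.* ↧ b)
    rat-eq = begin
      fromℤ (↧ a ℤ.* ↧ b) ℚ.* a ℚ.+ δ ℚ.* (0ℚ ℚ.* b)
        ≡⟨ cong (λ t → t ℚ.* a ℚ.+ δ ℚ.* (0ℚ ℚ.* b)) (fromℤ-* (↧ a) (↧ b)) ⟩
      (fromℤ (↧ a) ℚ.* fromℤ (↧ b)) ℚ.* a ℚ.+ δ ℚ.* (0ℚ ℚ.* b)
        ≡⟨ solve 5 (λ δ p q a b → (p :* q) :* a :+ δ :* (con 0ℚ :* b) := (a :* p) :* q) refl
             δ (fromℤ (↧ a)) (fromℤ (↧ b)) a b ⟩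
      (a ℚ.* fromℤ (↧ a)) ℚ.* fromℤ (↧ b)
        ≡⟨ cong (ℚ._* fromℤ (↧ b)) (*-denominator a) ⟩
      fromℤ (↥ a) ℚ.* fromℤ (↧ b)
        ≡⟨ sym (fromℤ-* (↥ a) (↧ b)) ⟩
      fromℤ (↥ a ℤ.* ↧ b) ∎

    irr-eq : fromℤ (↧ a ℤ.* ↧ b) ℚ.* b ℚ.+ 0ℚ ℚ.* a ≡ fromℤ (↥ b ℤ.* ↧ a)
    irr-eq = begin
      fromℤ (↧ a ℤ.* ↧ b) ℚ.* b ℚ.+ 0ℚ ℚ.* a
        ≡⟨ cong (λ t → t ℚ.* b ℚ.+ 0ℚ ℚ.* a) (fromℤ-* (↧ a) (↧ b)) ⟩
      (fromℤ (↧ a) ℚ.* fromℤ (↧ b)) ℚ.* b ℚ.+ 0ℚ ℚ.* a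
        ≡⟨ solve 4 (λ p q a b → (p :* q) :* b :+ con 0ℚ :* a := (b :* q) :* p) refl
             (fromℤ (↧ a)) (fromℤ (↧ b)) a b ⟩
      (b ℚ.* fromℤ (↧ b)) ℚ.* fromℤ (↧ a)
        ≡⟨ cong (ℚ._* fromℤ (↧ a)) (*-denominator b) ⟩
      fromℤ (↥ b) ℚ.* fromℤ (↧ a)
        ≡⟨ sym (fromℤ-* (↥ b) (↧ a)) ⟩
      fromℤ (↥ b ℤ.* ↧ a) ∎

  -- Integral elements have integer norms

  -- The ℤ-span of the values at x of all suffixes of the monic polynomial cs.
  -- Since  x · evalMonic cs x = evalMonic (c ∷ cs) x − c,  multiplication by x
  -- leads from the span of cs to that of c ∷ cs, and the latter is no larger
  -- when x is a root of c ∷ cs.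
  HornerSpan : K → List ℤ → Pred K 0ℓ
  HornerSpan x []           z = ∃[ e ] z ≡ ι e
  HornerSpan x cs@(_ ∷ cs′) z = ∃[ e ] ∃[ w ] w ∈ HornerSpan x cs′ × z ≡ ι e * evalMonic cs x + w

  module _ (x : K) where
    open K-Solver

    ι∈span : ∀ cs e → ι e ∈ HornerSpan x cs
    ι∈span []       e = e , refl
    ι∈span (c ∷ cs) e = ℤ.0ℤ , ι e , ι∈span cs e ,
      solve 2 (λ e h → e := con ℤ.0ℤ :* h :+ e) refl (ι e) (evalMonic (c ∷ cs) x)

    span-+ : ∀ cs {y z} → y ∈ HornerSpan x cs → z ∈ HornerSpan x cs → y + z ∈ HornerSpan x cs
    span-+ [] (e , refl) (f , refl) = e ℤ.+ f , sym (ι-+ e f)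
    span-+ (c ∷ cs) (e , v , v∈ , refl) (f , w , w∈ , refl) =
      e ℤ.+ f , v + w , span-+ cs v∈ w∈ , (begin
        (ι e * h + v) + (ι f * h + w)
          ≡⟨ solve 5 (λ e f v w h → (e :* h :+ v) :+ (f :* h :+ w) := (e :+ f) :* h :+ (v :+ w))
               refl (ι e) (ι f) v w h ⟩
        (ι e + ι f) * h + (v + w)
          ≡⟨ cong (λ t → t * h + (v + w)) (sym (ι-+ e f)) ⟩
        ι (e ℤ.+ f) * h + (v + w) ∎)
      where h = evalMonic (c ∷ cs) x

    ι-neg-* : ∀ e c → ι (ℤ.- (e ℤ.* c)) ≡ -K (ι e * ι c)
    ι-neg-* e c = trans (ι-neg (e ℤ.* c)) (cong -K_ (ι-* e c))

    x*span : ∀ c cs {w} → w ∈ HornerSpan x cs → x * w ∈ HornerSpan x (c ∷ cs)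
    x*span c [] (e , refl) =
      e , ι (ℤ.- (e ℤ.* c)) , ι∈span [] (ℤ.- (e ℤ.* c)) , (begin
        x * ι e
          ≡⟨ solve 3 (λ x e c → x :* e := e :* (c :+ x :* con ℤ.1ℤ) :+ (:- (e :* c))) refl x (ι e) (ι c) ⟩
        ι e * (ι c + x * 1#) + -K (ι e * ι c)
          ≡⟨ cong (λ t → ι e * (ι c + x * 1#) + t) (sym (ι-neg-* e c)) ⟩
        ι e * (ι c + x * 1#) + ι (ℤ.- (e ℤ.* c)) ∎)
    x*span c cs@(c′ ∷ cs′) (e , w , w∈ , refl) =
      e , ι (ℤ.- (e ℤ.* c)) + x * w
        , span-+ cs (ι∈span cs (ℤ.- (e ℤ.* c))) (x*span c′ cs′ w∈) , (begin
        x * (ι e * h + w)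
          ≡⟨ solve 5 (λ x e c h w → x :* (e :* h :+ w) := e :* (c :+ x :* h) :+ ((:- (e :* c)) :+ x :* w))
               refl x (ι e) (ι c) h w ⟩
        ι e * (ι c + x * h) + (-K (ι e * ι c) + x * w)
          ≡⟨ cong (λ t → ι e * (ι c + x * h) + (t + x * w)) (sym (ι-neg-* e c)) ⟩
        ι e * (ι c + x * h) + (ι (ℤ.- (e ℤ.* c)) + x * w) ∎)
      where h = evalMonic cs x

    drop-root : ∀ c cs {w} → evalMonic (c ∷ cs) x ≡ 0# → w ∈ HornerSpan x (c ∷ cs) → w ∈ HornerSpan x cs
    drop-root c cs root (e , w , w∈ , refl) = subst (HornerSpan x cs) (begin
      w                                ≡⟨ solve 2 (λ e w → w := e :* con ℤ.0ℤ :+ w) refl (ι e) w ⟩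
      ι e * 0# + w                     ≡⟨ cong (λ t → ι e * t + w) (sym root) ⟩
      ι e * evalMonic (c ∷ cs) x + w   ∎) w∈

    combined-denominator : ∀ p q e h w → ι p * h ∈ 𝓛 → ι q * w ∈ 𝓛 →
                           ι (p ℤ.* q) * (ι e * h + w) ∈ 𝓛
    combined-denominator p q e h w ph∈ qw∈ = subst 𝓛 (begin
      ι q * ι e * (ι p * h) + ι p * (ι q * w)
        ≡⟨ solve 5 (λ p q e h w → q :* e :* (p :* h) :+ p :* (q :* w) := (p :* q) :* (e :* h :+ w))
             refl (ι p) (ι q) (ι e) h w ⟩
      (ι p * ι q) * (ι e * h + w)
        ≡⟨ cong (_* (ι e * h + w)) (sym (ι-* p q)) ⟩
      ι (p ℤ.* q) * (ι e * h + w) ∎)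
      (𝓛-+ {ι q * ι e * (ι p * h)} {ι p * (ι q * w)}
        (𝓛-* {ι q * ι e} {ι p * h} (𝓛-* {ι q} {ι e} (ι∈𝓛 q) (ι∈𝓛 e)) ph∈)
        (𝓛-* {ι p} {ι q * w} (ι∈𝓛 p) qw∈))

    -- The span has finitely many generators, so the product of their denominators clears all of its
    -- elements at once. For the powers of an element this is a bound independent of the exponent.
    span-denominator : ∀ cs → ∃[ d ] d ≢ ℤ.0ℤ × (∀ w → w ∈ HornerSpan x cs → ι d * w ∈ 𝓛)
    span-denominator [] = ℤ.1ℤ , (λ ()) , λ { _ (e , refl) → 𝓛-* {ι ℤ.1ℤ} {ι e} (ι∈𝓛 ℤ.1ℤ) (ι∈𝓛 e) }
    span-denominator (c ∷ cs) =
      let d₁ , d₁≢0 , d₁h∈   = common-denominator (evalMonic (c ∷ cs) x)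
          d₂ , d₂≢0 , d₂span = span-denominator cs
      in d₁ ℤ.* d₂ , *-≢0 d₁ d₂ d₁≢0 d₂≢0 , λ { _ (e , w , w∈ , refl) →
           combined-denominator d₁ d₂ e (evalMonic (c ∷ cs) x) w d₁h∈ (d₂span w w∈) }

  infixr 8 _^K_
  _^K_ : K → ℕ → K
  y ^K zero  = 1#
  y ^K suc k = y * y ^K k

  norm-^K : ∀ y k → norm (y ^K k) ≡ norm y ^ℚ k
  norm-^K y zero    = norm-ι ℤ.1ℤ
  norm-^K y (suc k) = trans (norm-* y (y ^K k)) (cong (norm y ℚ.*_) (norm-^K y k))

  module _ (x : K) (c : ℤ) (cs : List ℤ) (root : evalMonic (c ∷ cs) x ≡ 0#) where

    -- Since 1 lies in the span, so does every power of y, and a single d puts all d yᵏ into ℤ[√D].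
    -- Taking norms, d² N(y)ᵏ is an integer for every k, so the denominators of these powers are
    -- bounded.
    stabiliser⇒integer-norm : ∀ y → (∀ {w} → w ∈ HornerSpan x cs → y * w ∈ HornerSpan x cs) →
                              IsInteger (norm y)
    stabiliser⇒integer-norm y y*span with span-denominator x cs
    ... | d , d≢0 , d*span∈𝓛 = bounded-denominators⇒integer (d ℤ.* d) (norm y) (*-≢0 d d d≢0 d≢0) integer
      where
      y^k∈span : ∀ k → y ^K k ∈ HornerSpan x cs
      y^k∈span zero    = ι∈span x cs ℤ.1ℤ
      y^k∈span (suc k) = y*span (y^k∈span k)

      integer : ∀ k → IsInteger (fromℤ (d ℤ.* d) ℚ.* norm y ^ℚ k)
      integer k with 𝓛⇒integer-norm (d*span∈𝓛 (y ^K k) (y^k∈span k))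
      ... | e , eq = e , (begin
        fromℤ (d ℤ.* d) ℚ.* norm y ^ℚ k    ≡⟨ cong₂ ℚ._*_ (sym (norm-ι d)) (sym (norm-^K y k)) ⟩
        norm (ι d) ℚ.* norm (y ^K k)       ≡⟨ sym (norm-* (ι d) (y ^K k)) ⟩
        norm (ι d * y ^K k)                ≡⟨ eq ⟩
        fromℤ e                            ∎)

    integer-norm : IsInteger (norm x)
    integer-norm = stabiliser⇒integer-norm x (λ w∈ → drop-root x c cs root (x*span x c cs w∈))

    -- A span that is closed under addition and stable under x is stable under x + 1. This norm is
    -- wanted for the trace, which is N(x + 1) - N(x) - 1.
    integer-norm-+1 : IsInteger (norm (x + 1#))
    integer-norm-+1 = stabiliser⇒integer-norm (x + 1#) (λ {w} w∈ → subst (HornerSpan x cs)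
      (solve 2 (λ x w → x :* w :+ w := (x :+ con ℤ.1ℤ) :* w) refl x w)
      (span-+ x cs (drop-root x c cs root (x*span x c cs w∈)) w∈))
      where open K-Solver

  𝓞⇒integer-norms : ∀ {x} → x ∈ 𝓞 → IsInteger (norm x) × IsInteger (norm (x + 1#))
  𝓞⇒integer-norms ([] , ())
  𝓞⇒integer-norms {x} (c ∷ cs , root) = integer-norm x c cs root , integer-norm-+1 x c cs root

-- The ring of integers for squarefree D ≡ 2 modulo 4

parity : ∀ t → ∃[ s ] (t ≡ + 2 ℤ.* s ⊎ t ≡ + 1 ℤ.+ + 2 ℤ.* s)
parity t with t %ℕ 2 | n%ℕd<d t 2 | a≡a%ℕn+[a/ℕn]*n t 2
... | 0 | _ | eq = t /ℕ 2 , inj₁ (trans eq (trans (ℤ.+-identityˡ _) (ℤ.*-comm (t /ℕ 2) (+ 2))))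
... | 1 | _ | eq = t /ℕ 2 , inj₂ (trans eq (cong (ℤ._+_ (+ 1)) (ℤ.*-comm (t /ℕ 2) (+ 2))))
... | suc (suc _) | s≤s (s≤s ()) | _

4∤1 : ∀ w → + 4 ℤ.* w ≢ + 1
4∤1 w eq = contradiction
  (∣⇒≤ (divides ∣ w ∣ (trans (cong ∣_∣ (sym eq)) (trans (ℤ.abs-* (+ 4) w) (ℕ.*-comm 4 ∣ w ∣)))))
  λ { (s≤s ()) }

4∤2 : ∀ w → + 4 ℤ.* w ≢ + 2
4∤2 w eq = contradiction
  (∣⇒≤ (divides ∣ w ∣ (trans (cong ∣_∣ (sym eq)) (trans (ℤ.abs-* (+ 4) w) (ℕ.*-comm 4 ∣ w ∣)))))
  λ { (s≤s (s≤s ())) }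

-- The hypothesis says t² ≡ 2v² modulo 4, and squares are 0 or 1 modulo 4. So v odd is impossible,
-- and v even forces t even. In each excluded case `W` is the quotient by 4 left after the parities
-- are substituted, so that 4W would be 1 or 2.
coefficients-even : ∀ j t v m → (+ 2 ℤ.+ + 4 ℤ.* j) ℤ.* (v ℤ.* v) ≡ t ℤ.* t ℤ.- + 4 ℤ.* m →
  ∃[ s ] ∃[ w ] t ≡ + 2 ℤ.* s × v ≡ + 2 ℤ.* w
coefficients-even j t v m eq with parity t | parity v
... | s , inj₁ t≡ | w , inj₁ v≡ = s , w , t≡ , v≡
... | s , inj₁ refl | w , inj₂ refl = contradiction (begin
    + 4 ℤ.* W                                       ≡⟨ solve 4 (λ j s w m →
      con (+ 4) :* (s :* s :- m :- j :* ((con (+ 1) :+ con (+ 2) :* w) :* (con (+ 1) :+ con (+ 2) :* w)) :- con (+ 2) :* (w :+ w :* w)) :=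
      con (+ 2) :+ ((con (+ 2) :* s) :* (con (+ 2) :* s) :- con (+ 4) :* m :-
        (con (+ 2) :+ con (+ 4) :* j) :* ((con (+ 1) :+ con (+ 2) :* w) :* (con (+ 1) :+ con (+ 2) :* w)))) refl j s w m ⟩
    + 2 ℤ.+ (R ℤ.- L)                               ≡⟨ cong (λ z → + 2 ℤ.+ z) (ℤ.i≡j⇒i-j≡0 {R} {L} (sym eq)) ⟩
    + 2                                             ∎) (4∤2 W)
  where
  open ℤ-Solver
  open ≡-Reasoning
  W L R : ℤ
  W = s ℤ.* s ℤ.- m ℤ.- j ℤ.* (v ℤ.* v) ℤ.- + 2 ℤ.* (w ℤ.+ w ℤ.* w)
  L = (+ 2 ℤ.+ + 4 ℤ.* j) ℤ.* (v ℤ.* v)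
  R = t ℤ.* t ℤ.- + 4 ℤ.* m
... | s , inj₂ refl | w , inj₁ refl = contradiction (begin
    + 4 ℤ.* W                                       ≡⟨ solve 4 (λ j s w m →
      con (+ 4) :* ((con (+ 2) :+ con (+ 4) :* j) :* (w :* w) :- s :- s :* s :+ m) :=
      con (+ 1) :+ (:- (((con (+ 1) :+ con (+ 2) :* s) :* (con (+ 1) :+ con (+ 2) :* s)) :- con (+ 4) :* m :-
        (con (+ 2) :+ con (+ 4) :* j) :* ((con (+ 2) :* w) :* (con (+ 2) :* w))))) refl j s w m ⟩
    + 1 ℤ.+ ℤ.- (R ℤ.- L)                           ≡⟨ cong (λ z → + 1 ℤ.+ ℤ.- z) (ℤ.i≡j⇒i-j≡0 {R} {L} (sym eq)) ⟩
    + 1                                             ∎) (4∤1 W)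
  where
  open ℤ-Solver
  open ≡-Reasoning
  W L R : ℤ
  W = (+ 2 ℤ.+ + 4 ℤ.* j) ℤ.* (w ℤ.* w) ℤ.- s ℤ.- s ℤ.* s ℤ.+ m
  L = (+ 2 ℤ.+ + 4 ℤ.* j) ℤ.* (v ℤ.* v)
  R = t ℤ.* t ℤ.- + 4 ℤ.* m
... | s , inj₂ refl | w , inj₂ refl = contradiction (begin
    + 4 ℤ.* W                                       ≡⟨ solve 4 (λ j s w m →
      con (+ 4) :* (s :+ s :* s :- m :- j :* ((con (+ 1) :+ con (+ 2) :* w) :* (con (+ 1) :+ con (+ 2) :* w)) :- con (+ 2) :* (w :+ w :* w)) :=
      con (+ 1) :+ (((con (+ 1) :+ con (+ 2) :* s) :* (con (+ 1) :+ con (+ 2) :* s)) :- con (+ 4) :* m :-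
        (con (+ 2) :+ con (+ 4) :* j) :* ((con (+ 1) :+ con (+ 2) :* w) :* (con (+ 1) :+ con (+ 2) :* w)))) refl j s w m ⟩
    + 1 ℤ.+ (R ℤ.- L)                               ≡⟨ cong (λ z → + 1 ℤ.+ z) (ℤ.i≡j⇒i-j≡0 {R} {L} (sym eq)) ⟩
    + 1                                             ∎) (4∤1 W)
  where
  open ℤ-Solver
  open ≡-Reasoning
  W L R : ℤ
  W = s ℤ.+ s ℤ.* s ℤ.- m ℤ.- j ℤ.* (v ℤ.* v) ℤ.- + 2 ℤ.* (w ℤ.+ w ℤ.* w)
  L = (+ 2 ℤ.+ + 4 ℤ.* j) ℤ.* (v ℤ.* v)
  R = t ℤ.* t ℤ.- + 4 ℤ.* m

-- For u = p/q in lowest terms, q² divides D p² and is coprime to p², so q² divides D and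
-- squarefreeness gives q = 1.
squarefree-multiple-integer : ∀ {D} → Squarefree D → ∀ u → IsInteger (fromℤ (+ D) ℚ.* (u ℚ.* u)) → IsInteger u
squarefree-multiple-integer {D} sf u (e , eq) = denominator-1⇒integer u (sf q
  (coprime-divisor (coprime-* (coprime-sym p⊥q²) (coprime-sym p⊥q²)) (divides ∣ e ∣ (begin
    ∣ p ∣ ℕ.* ∣ p ∣ ℕ.* D          ≡⟨ ℕ.*-comm (∣ p ∣ ℕ.* ∣ p ∣) D ⟩
    D ℕ.* (∣ p ∣ ℕ.* ∣ p ∣)        ≡⟨ cong (D ℕ.*_) (sym (ℤ.abs-* p p)) ⟩
    D ℕ.* ∣ p ℤ.* p ∣              ≡⟨ sym (ℤ.abs-* (+ D) (p ℤ.* p)) ⟩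
    ∣ + D ℤ.* (p ℤ.* p) ∣          ≡⟨ cong ∣_∣ (sym (fromℤ-injective (e ℤ.* (↧ u ℤ.* ↧ u)) (+ D ℤ.* (p ℤ.* p)) clear)) ⟩
    ∣ e ℤ.* (↧ u ℤ.* ↧ u) ∣        ≡⟨ ℤ.abs-* e (↧ u ℤ.* ↧ u) ⟩
    ∣ e ∣ ℕ.* ∣ ↧ u ℤ.* ↧ u ∣      ≡⟨ cong (∣ e ∣ ℕ.*_) (ℤ.abs-* (↧ u) (↧ u)) ⟩
    ∣ e ∣ ℕ.* (q ℕ.* q)            ∎))))
  where
  open ≡-Reasoning
  p = ↥ u
  q = ↧ₙ u
  δ Q : ℚ
  δ = fromℤ (+ D)
  Q = fromℤ (↧ u)

  p⊥q² : Coprime (∣ p ∣ ℕ.* ∣ p ∣) q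
  p⊥q² = coprime-* (numerator⊥denominator u) (numerator⊥denominator u)

  clear : fromℤ (e ℤ.* (↧ u ℤ.* ↧ u)) ≡ fromℤ (+ D ℤ.* (p ℤ.* p))
  clear = begin
    fromℤ (e ℤ.* (↧ u ℤ.* ↧ u))              ≡⟨ fromℤ-* e (↧ u ℤ.* ↧ u) ⟩
    fromℤ e ℚ.* fromℤ (↧ u ℤ.* ↧ u)          ≡⟨ cong₂ ℚ._*_ (sym eq) (fromℤ-* (↧ u) (↧ u)) ⟩
    δ ℚ.* (u ℚ.* u) ℚ.* (Q ℚ.* Q)            ≡⟨ solve 3 (λ d u q → d :* (u :* u) :* (q :* q) :=
                                                  d :* ((u :* q) :* (u :* q))) refl δ u Q ⟩
    δ ℚ.* ((u ℚ.* Q) ℚ.* (u ℚ.* Q))          ≡⟨ cong (λ t → δ ℚ.* (t ℚ.* t)) (*-denominator u) ⟩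
    δ ℚ.* (fromℤ p ℚ.* fromℤ p)              ≡⟨ cong (δ ℚ.*_) (sym (fromℤ-* p p)) ⟩
    δ ℚ.* fromℤ (p ℤ.* p)                    ≡⟨ sym (fromℤ-* (+ D) (p ℤ.* p)) ⟩
    fromℤ (+ D ℤ.* (p ℤ.* p))                ∎
    where open ℚ-Solver

half-integer : ∀ a s → a ℚ.+ a ≡ fromℤ (+ 2 ℤ.* s) → a ≡ fromℤ s
half-integer a s eq = begin
  a                              ≡⟨ solve 1 (λ a → a := con ½ :* (a :+ a)) refl a ⟩
  ½ ℚ.* (a ℚ.+ a)                ≡⟨ cong (½ ℚ.*_) (trans eq (fromℤ-* (+ 2) s)) ⟩
  ½ ℚ.* (fromℤ (+ 2) ℚ.* fromℤ s) ≡⟨ solve 1 (λ s → con ½ :* (con (fromℤ (+ 2)) :* s) := s) refl (fromℤ s) ⟩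
  fromℤ s                        ∎
  where
  open ≡-Reasoning
  open ℚ-Solver

module RingOfIntegers (D : ℕ) (squarefree : Squarefree D) (j : ℕ) (D≡2+4j : D ≡ 2 ℕ.+ 4 ℕ.* j) where
  open QuadraticField D
  open QuadraticRing D
  open ≡-Reasoning

  -- Let t = 2a be the trace and m the norm of x = a + b√D. The discriminant t² - 4m equals D(2b)²,
  -- so 2b is an integer because D is squarefree; the congruence modulo 4 then makes 2a and 2b even.
  𝓞⊆𝓛 : 𝓞 ⊆ 𝓛
  𝓞⊆𝓛 {x@(a +√ b)} x∈𝓞 with 𝓞⇒integer-norms x∈𝓞
  ... | (m , norm≡m) , (m′ , norm≡m′) = s , w , cong₂ _+√_ (half-integer a s (trans 2a≡t (cong fromℤ t≡2s)))
                                                          (half-integer b w (trans u≡v (cong fromℤ v≡2w)))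
    where
    t : ℤ
    t = m′ ℤ.- m ℤ.- + 1

    2a≡t : a ℚ.+ a ≡ fromℤ t
    2a≡t = begin
      a ℚ.+ a
        ≡⟨ solve 3 (λ δ a b → a :+ a :=
             ((a :+ con 1ℚ) :* (a :+ con 1ℚ) :+ (:- (δ :* ((b :+ con 0ℚ) :* (b :+ con 0ℚ)))))
               :+ (:- (a :* a :+ (:- (δ :* (b :* b))))) :+ (:- (con 1ℚ))) refl δ a b ⟩
      norm (x + 1#) ℚ.+ ℚ.- norm x ℚ.+ ℚ.- 1ℚ
        ≡⟨ cong₂ (λ p q → p ℚ.+ ℚ.- q ℚ.+ ℚ.- 1ℚ) norm≡m′ norm≡m ⟩
      fromℤ m′ ℚ.+ ℚ.- fromℤ m ℚ.+ ℚ.- 1ℚ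
        ≡⟨ cong (λ q → fromℤ m′ ℚ.+ q ℚ.+ ℚ.- 1ℚ) (sym (fromℤ-neg m)) ⟩
      fromℤ m′ ℚ.+ fromℤ (ℤ.- m) ℚ.+ fromℤ (ℤ.- + 1)
        ≡⟨ cong (ℚ._+ fromℤ (ℤ.- + 1)) (sym (fromℤ-+ m′ (ℤ.- m))) ⟩
      fromℤ (m′ ℤ.- m) ℚ.+ fromℤ (ℤ.- + 1)
        ≡⟨ sym (fromℤ-+ (m′ ℤ.- m) (ℤ.- + 1)) ⟩
      fromℤ t ∎
      where open ℚ-Solver

    u : ℚ
    u = b ℚ.+ b

    Du²≡ : δ ℚ.* (u ℚ.* u) ≡ fromℤ (t ℤ.* t ℤ.- + 4 ℤ.* m)
    Du²≡ = begin
      δ ℚ.* (u ℚ.* u)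
        ≡⟨ solve 3 (λ δ a b → δ :* ((b :+ b) :* (b :+ b)) :=
             (a :+ a) :* (a :+ a) :+ (:- (con (fromℤ (+ 4)) :* (a :* a :+ (:- (δ :* (b :* b))))))) refl δ a b ⟩
      (a ℚ.+ a) ℚ.* (a ℚ.+ a) ℚ.+ ℚ.- (fromℤ (+ 4) ℚ.* norm x)
        ≡⟨ cong₂ (λ p q → p ℚ.* p ℚ.+ ℚ.- (fromℤ (+ 4) ℚ.* q)) 2a≡t norm≡m ⟩
      fromℤ t ℚ.* fromℤ t ℚ.+ ℚ.- (fromℤ (+ 4) ℚ.* fromℤ m)
        ≡⟨ cong₂ (λ p q → p ℚ.+ ℚ.- q) (sym (fromℤ-* t t)) (sym (fromℤ-* (+ 4) m)) ⟩
      fromℤ (t ℤ.* t) ℚ.+ ℚ.- fromℤ (+ 4 ℤ.* m)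
        ≡⟨ cong (fromℤ (t ℤ.* t) ℚ.+_) (sym (fromℤ-neg (+ 4 ℤ.* m))) ⟩
      fromℤ (t ℤ.* t) ℚ.+ fromℤ (ℤ.- (+ 4 ℤ.* m))
        ≡⟨ sym (fromℤ-+ (t ℤ.* t) (ℤ.- (+ 4 ℤ.* m))) ⟩
      fromℤ (t ℤ.* t ℤ.- + 4 ℤ.* m) ∎
      where open ℚ-Solver

    u-integer : IsInteger u
    u-integer = squarefree-multiple-integer squarefree u (t ℤ.* t ℤ.- + 4 ℤ.* m , Du²≡)

    v : ℤ
    v = proj₁ u-integer

    u≡v : u ≡ fromℤ v
    u≡v = proj₂ u-integer

    Dv²≡ : (+ 2 ℤ.+ + 4 ℤ.* + j) ℤ.* (v ℤ.* v) ≡ t ℤ.* t ℤ.- + 4 ℤ.* m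
    Dv²≡ = fromℤ-injective ((+ 2 ℤ.+ + 4 ℤ.* + j) ℤ.* (v ℤ.* v)) (t ℤ.* t ℤ.- + 4 ℤ.* m) (begin
      fromℤ ((+ 2 ℤ.+ + 4 ℤ.* + j) ℤ.* (v ℤ.* v))  ≡⟨ cong (λ d → fromℤ (d ℤ.* (v ℤ.* v))) (sym D≡ℤ) ⟩
      fromℤ (+ D ℤ.* (v ℤ.* v))                    ≡⟨ trans (fromℤ-* (+ D) (v ℤ.* v)) (cong (δ ℚ.*_) (fromℤ-* v v)) ⟩
      δ ℚ.* (fromℤ v ℚ.* fromℤ v)                  ≡⟨ cong (λ z → δ ℚ.* (z ℚ.* z)) (sym u≡v) ⟩
      δ ℚ.* (u ℚ.* u)                              ≡⟨ Du²≡ ⟩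
      fromℤ (t ℤ.* t ℤ.- + 4 ℤ.* m)                ∎)
      where
      D≡ℤ : + D ≡ + 2 ℤ.+ + 4 ℤ.* + j
      D≡ℤ = trans (cong +_ D≡2+4j) (cong (λ z → + 2 ℤ.+ z) (ℤ.pos-* 4 j))

    evens = coefficients-even (+ j) t v m Dv²≡
    s = proj₁ evens
    w = proj₁ (proj₂ evens)
    t≡2s = proj₁ (proj₂ (proj₂ evens))
    v≡2w = proj₂ (proj₂ (proj₂ evens))

  -- The witness is the characteristic polynomial X² - 2aX + (a² - Db²), constant term first.
  𝓛⊆𝓞 : 𝓛 ⊆ 𝓞
  𝓛⊆𝓞 (a , b , refl) = normℤ a b ∷ ℤ.- (a ℤ.+ a) ∷ [] , (begin
    embed N (+ 0) + x * (embed T (+ 0) + x * embed (+ 1) (+ 0))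
      ≡⟨ cong (λ y → embed N (+ 0) + x * (embed T (+ 0) + y)) (embed-* a b (+ 1) (+ 0)) ⟩
    _ ≡⟨ cong (λ y → embed N (+ 0) + x * y) (embed-+ T (+ 0) a₁ b₁) ⟩
    _ ≡⟨ cong (λ z → embed N (+ 0) + z) (embed-* a b (T ℤ.+ a₁) (+ 0 ℤ.+ b₁)) ⟩
    _ ≡⟨ embed-+ N (+ 0) (a ℤ.* (T ℤ.+ a₁) ℤ.+ + D ℤ.* (b ℤ.* (+ 0 ℤ.+ b₁))) (a ℤ.* (+ 0 ℤ.+ b₁) ℤ.+ b ℤ.* (T ℤ.+ a₁)) ⟩
    _ ≡⟨ cong₂ embed
         (solve 3 (λ d a b →
           (a :* a :- d :* (b :* b)) :+ (a :* (:- (a :+ a) :+ (a :* con (+ 1) :+ d :* (b :* con (+ 0))))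
             :+ d :* (b :* (con (+ 0) :+ (a :* con (+ 0) :+ b :* con (+ 1))))) := con (+ 0)) refl (+ D) a b)
         (solve 3 (λ d a b →
           con (+ 0) :+ (a :* (con (+ 0) :+ (a :* con (+ 0) :+ b :* con (+ 1)))
             :+ b :* (:- (a :+ a) :+ (a :* con (+ 1) :+ d :* (b :* con (+ 0))))) := con (+ 0)) refl (+ D) a b) ⟩
    0# ∎)
    where
    open ℤ-Solver
    N T a₁ b₁ : ℤ
    N = normℤ a b
    T = ℤ.- (a ℤ.+ a)
    a₁ = a ℤ.* + 1 ℤ.+ + D ℤ.* (b ℤ.* + 0)
    b₁ = a ℤ.* + 0 ℤ.+ b ℤ.* + 1
    x : K
    x = embed a b

-- Descent for a² - Db² = ±2 and for a² = Db²

module ℕ-Descent where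
  open import Data.Nat.Base using (_+_; _*_; _≤_; _<_)
  open ℕ-Solver

  strictly-between-squares : ∀ k {m} a → k * k < m → m < suc k * suc k → a * a ≢ m
  strictly-between-squares k a k²<m m<k′² refl with a ℕ.≤? k
  ... | yes a≤k = ℕ.<⇒≱ k²<m (ℕ.*-mono-≤ a≤k a≤k)
  ... | no  a≰k = ℕ.<⇒≱ m<k′² (ℕ.*-mono-≤ (ℕ.≰⇒> a≰k) (ℕ.≰⇒> a≰k))

  -- Multiplication by −n + √D, an element of norm −1, sends a + b√D to
  -- (b − cn) + c√D with c = a − bn, and 0 < c < b as long as b ≥ 2.  The equation
  -- a² − Db² = f − e is written without subtraction.
  module _ (n : ℕ) (1≤n : 1 ≤ n) where

    D : ℕ
    D = n * n + 1

    -- A step of norm -1 swaps `e` and `f`, so the base case b = 1 is assumed for both orders. The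
    -- bound 2 keeps the two constants below b² ≥ 4 and 2b²n ≥ 4, which is what gives bn < a and c <
    -- b.
    no-representation : ∀ b e f → e ≤ 2 → f ≤ 2 →
      (∀ a → a * a + e ≢ D + f) → (∀ a → a * a + f ≢ D + e) →
      0 < b → ∀ a → a * a + e ≢ D * (b * b) + f
    no-representation = <-rec _ step
      where
      step : ∀ b → (∀ {c} → c < b → ∀ e f → e ≤ 2 → f ≤ 2 →
        (∀ a → a * a + e ≢ D + f) → (∀ a → a * a + f ≢ D + e) →
        0 < c → ∀ a → a * a + e ≢ D * (c * c) + f) →
        ∀ e f → e ≤ 2 → f ≤ 2 →
        (∀ a → a * a + e ≢ D + f) → (∀ a → a * a + f ≢ D + e) →
        0 < b → ∀ a → a * a + e ≢ D * (b * b) + f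
      step 1 _ e f _ _ base _ _ a eq = base a (trans eq (cong (_+ f) (ℕ.*-identityʳ D)))
      step b@(suc (suc _)) rec e f e≤2 f≤2 base base′ _ a eq
        with ℕ.m≤n⇒∃[o]m+o≡n bn<a
        where
        open ℕ.≤-Reasoning
        bn<a : b * n < a
        bn<a = ℕ.≰⇒> λ a≤bn → ℕ.<-irrefl eq (begin-strict
          a * a + e                          ≤⟨ ℕ.+-mono-≤ (ℕ.*-mono-≤ a≤bn a≤bn) e≤2 ⟩
          (b * n) * (b * n) + 2              <⟨ ℕ.+-monoʳ-< ((b * n) * (b * n)) (ℕ.≤-trans (s≤s (s≤s (s≤s z≤n)))
                                                  (ℕ.*-mono-≤ {2} {b} {2} {b} (s≤s (s≤s z≤n)) (s≤s (s≤s z≤n)))) ⟩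
          (b * n) * (b * n) + b * b          ≡⟨ solve 2 (λ b n → (b :* n) :* (b :* n) :+ b :* b :=
                                                  (n :* n :+ con 1) :* (b :* b)) refl b n ⟩
          D * (b * b)                        ≤⟨ ℕ.m≤m+n (D * (b * b)) f ⟩
          D * (b * b) + f                    ∎)
      -- `bn<a` means `suc (b * n) ≤ a`, so the difference obtained is one less than c = a - bn.
      ... | c-1 , refl = contradict
        where
        c = suc c-1

        c<b : c < b
        c<b = ℕ.≰⇒> λ b≤c → ℕ.<-irrefl (sym eq) (begin-strict
          D * (b * b) + f                            ≤⟨ ℕ.+-monoʳ-≤ (D * (b * b)) f≤2 ⟩
          D * (b * b) + 2                            <⟨ ℕ.+-monoʳ-< (D * (b * b)) (ℕ.≤-trans (s≤s (s≤s (s≤s z≤n)))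
                                                          (ℕ.*-mono-≤ {4} {2 * (b * b)} {1} {n}
                                                            (ℕ.*-monoʳ-≤ 2 2≤b²) 1≤n)) ⟩
          D * (b * b) + 2 * (b * b) * n              ≡⟨ solve 2 (λ b n → (n :* n :+ con 1) :* (b :* b) :+ con 2 :* (b :* b) :* n :=
                                                          (b :* n :+ b) :* (b :* n :+ b)) refl b n ⟩
          (b * n + b) * (b * n + b)                  ≤⟨ ℕ.*-mono-≤ (ℕ.+-monoʳ-≤ (b * n) b≤c) (ℕ.+-monoʳ-≤ (b * n) b≤c) ⟩
          (b * n + c) * (b * n + c)                  ≡⟨ cong (λ t → t * t) (ℕ.+-suc (b * n) c-1) ⟩
          a * a                                      ≤⟨ ℕ.m≤m+n (a * a) e ⟩
          a * a + e                                  ∎)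
          where
          open ℕ.≤-Reasoning
          2≤b² : 2 ≤ b * b
          2≤b² = ℕ.*-mono-≤ {2} {b} {1} {b} (s≤s (s≤s z≤n)) (s≤s z≤n)

        open ≡-Reasoning

        -- The equation after substituting a = bn + c and cancelling (bn)². Rearranged, it says (b -
        -- cn)² + f = Dc² + e.
        reduced : 2 * b * c * n + c * c + e ≡ b * b + f
        reduced = ℕ.+-cancelˡ-≡ (b * n * (b * n)) _ _ (begin
          b * n * (b * n) + (2 * b * c * n + c * c + e)
            ≡⟨ solve 4 (λ b n c e → b :* n :* (b :* n) :+ (con 2 :* b :* c :* n :+ c :* c :+ e) :=
                 (b :* n :+ c) :* (b :* n :+ c) :+ e) refl b n c e ⟩
          (b * n + c) * (b * n + c) + e
            ≡⟨ cong (λ t → t * t + e) (ℕ.+-suc (b * n) c-1) ⟩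
          a * a + e
            ≡⟨ eq ⟩
          D * (b * b) + f
            ≡⟨ solve 3 (λ b n f → (n :* n :+ con 1) :* (b :* b) :+ f := b :* n :* (b :* n) :+ (b :* b :+ f)) refl b n f ⟩
          b * n * (b * n) + (b * b + f) ∎)

        smaller : ∀ a′ → a′ * a′ + f ≢ D * (c * c) + e
        smaller = rec c<b f e f≤2 e≤2 base′ base (s≤s z≤n)

        -- The new coordinate b - cn may have either sign. Only its absolute value `t` matters, and
        -- each order of cn and b yields it without subtraction.
        contradict = case-distance (ℕ.≤-total (c * n) b)
          where
          case-distance : _ → _
          case-distance (inj₁ cn≤b) with ℕ.m≤n⇒∃[o]m+o≡n cn≤b
          ... | t , cn+t≡b = smaller t (ℕ.+-cancelˡ-≡ (c * n * (c * n) + 2 * c * n * t) _ _ (begin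
            c * n * (c * n) + 2 * c * n * t + (t * t + f)
              ≡⟨ solve 4 (λ c n t f → c :* n :* (c :* n) :+ con 2 :* c :* n :* t :+ (t :* t :+ f) :=
                   (c :* n :+ t) :* (c :* n :+ t) :+ f) refl c n t f ⟩
            (c * n + t) * (c * n + t) + f
              ≡⟨ cong (λ s → s * s + f) cn+t≡b ⟩
            b * b + f
              ≡⟨ sym reduced ⟩
            2 * b * c * n + c * c + e
              ≡⟨ cong (λ s → 2 * s * c * n + c * c + e) (sym cn+t≡b) ⟩
            2 * (c * n + t) * c * n + c * c + e
              ≡⟨ solve 4 (λ c n t e → con 2 :* (c :* n :+ t) :* c :* n :+ c :* c :+ e :=
                   c :* n :* (c :* n) :+ con 2 :* c :* n :* t :+ ((n :* n :+ con 1) :* (c :* c) :+ e)) refl c n t e ⟩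
            c * n * (c * n) + 2 * c * n * t + (D * (c * c) + e) ∎))
          case-distance (inj₂ b≤cn) with ℕ.m≤n⇒∃[o]m+o≡n b≤cn
          ... | t , b+t≡cn = smaller t (ℕ.+-cancelˡ-≡ (b * b) _ _ (begin
            b * b + (t * t + f)
              ≡⟨ solve 3 (λ b t f → b :* b :+ (t :* t :+ f) := b :* b :+ f :+ t :* t) refl b t f ⟩
            b * b + f + t * t
              ≡⟨ cong (_+ t * t) (sym reduced) ⟩
            2 * b * c * n + c * c + e + t * t
              ≡⟨ solve 5 (λ b c n e t → con 2 :* b :* c :* n :+ c :* c :+ e :+ t :* t :=
                   con 2 :* b :* (c :* n) :+ t :* t :+ c :* c :+ e) refl b c n e t ⟩
            2 * b * (c * n) + t * t + c * c + e
              ≡⟨ cong (λ s → 2 * b * s + t * t + c * c + e) (sym b+t≡cn) ⟩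
            2 * b * (b + t) + t * t + c * c + e
              ≡⟨ solve 4 (λ b t c e → con 2 :* b :* (b :+ t) :+ t :* t :+ c :* c :+ e :=
                   b :* b :+ ((b :+ t) :* (b :+ t) :+ c :* c :+ e)) refl b t c e ⟩
            b * b + ((b + t) * (b + t) + c * c + e)
              ≡⟨ cong (λ s → b * b + (s * s + c * c + e)) b+t≡cn ⟩
            b * b + (c * n * (c * n) + c * c + e)
              ≡⟨ solve 4 (λ b c n e → b :* b :+ (c :* n :* (c :* n) :+ c :* c :+ e) :=
                   b :* b :+ ((n :* n :+ con 1) :* (c :* c) :+ e)) refl b c n e ⟩
            b * b + (D * (c * c) + e) ∎))

    D-nonsquare : ∀ a → a * a ≢ D
    D-nonsquare a = strictly-between-squares n a n²<D D<n′²
      where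
      n²<D : n * n < D
      n²<D = ℕ.m<m+n (n * n) (s≤s z≤n)
      D<n′² : D < suc n * suc n
      D<n′² = ℕ.<-≤-trans (ℕ.m<m+n D {n + n} (ℕ.≤-trans 1≤n (ℕ.m≤m+n n n)))
        (ℕ.≤-reflexive (solve 1 (λ n → n :* n :+ con 1 :+ (n :+ n) := (con 1 :+ n) :* (con 1 :+ n)) refl n))

    -- The descent with e = f = 0 is the irrationality of √D. It serves to show that nonzero
    -- elements have nonzero norm.
    square≡D*square⇒0 : ∀ a b → a * a ≡ D * (b * b) → b ≡ 0
    square≡D*square⇒0 a zero    eq = refl
    square≡D*square⇒0 a (suc b) eq = contradiction (cong (_+ 0) eq)
      (no-representation (suc b) 0 0 z≤n z≤n base base (s≤s z≤n) a)
      where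
      base : ∀ a → a * a + 0 ≢ D + 0
      base a eq = D-nonsquare a (ℕ.+-cancelʳ-≡ 0 _ _ eq)

  module _ (k : ℕ) (1≤k : 1 ≤ k) where

    private
      n = suc k
      E = n * n + 1

    -- Since n ≥ 2, n² < n² + 3 < (n + 1)².
    strictly-above : ∀ a → a * a + 0 ≢ E + 2
    strictly-above a eq = strictly-between-squares n a
      (ℕ.≤-trans (ℕ.m<m+n (n * n) (s≤s z≤n)) (ℕ.m≤m+n E 2))
      (ℕ.<-≤-trans (ℕ.m<m+n (E + 2) {2 * k} (ℕ.≤-trans 1≤k (ℕ.m≤m+n k _)))
        (ℕ.≤-reflexive (solve 1 (λ k → (con 1 :+ k) :* (con 1 :+ k) :+ con 1 :+ con 2 :+ con 2 :* k :=
          (con 2 :+ k) :* (con 2 :+ k)) refl k)))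
      (trans (sym (ℕ.+-identityʳ (a * a))) eq)

    -- D - 2 = k² + 2k lies strictly between k² and (k + 1)², the left inequality being strict
    -- because k ≥ 1.
    strictly-below : ∀ a → a * a + 2 ≢ E + 0
    strictly-below a eq = strictly-between-squares k a
      (ℕ.m<m+n (k * k) {2 * k} (ℕ.≤-trans 1≤k (ℕ.m≤m+n k _)))
      (ℕ.≤-reflexive (solve 1 (λ k → con 1 :+ (k :* k :+ con 2 :* k) := (con 1 :+ k) :* (con 1 :+ k)) refl k))
      (ℕ.+-cancelʳ-≡ 2 _ _ (trans eq
        (solve 1 (λ k → (con 1 :+ k) :* (con 1 :+ k) :+ con 1 :+ con 0 := k :* k :+ con 2 :* k :+ con 2) refl k)))

  norm≢2 : ∀ n → 1 < n → ∀ a b → a * a + 0 ≢ (n * n + 1) * (b * b) + 2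
  norm≢2 n@(suc k) (s≤s 1≤k) a (suc b) = no-representation n (s≤s z≤n) (suc b) 0 2 z≤n ℕ.≤-refl
    (strictly-above k 1≤k) (strictly-below k 1≤k) (s≤s z≤n) a
  -- The descent needs b > 0; for b = 0 the equation says that 2 is a square.
  norm≢2 n _ a zero eq = strictly-between-squares 1 a (s≤s (s≤s z≤n)) (s≤s (s≤s (s≤s z≤n))) (begin
    a * a                  ≡⟨ sym (ℕ.+-identityʳ (a * a)) ⟩
    a * a + 0              ≡⟨ eq ⟩
    (n * n + 1) * 0 + 2    ≡⟨ cong (_+ 2) (ℕ.*-zeroʳ (n * n + 1)) ⟩
    2                      ∎)
    where open ≡-Reasoning

  norm≢-2 : ∀ n → 1 < n → ∀ a b → a * a + 2 ≢ (n * n + 1) * (b * b) + 0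
  norm≢-2 n@(suc k) (s≤s 1≤k) a (suc b) = no-representation n (s≤s z≤n) (suc b) 2 0 ℕ.≤-refl z≤n
    (strictly-below k 1≤k) (strictly-above k 1≤k) (s≤s z≤n) a
  norm≢-2 n _ a zero eq = contradiction (begin
    2 + a * a              ≡⟨ ℕ.+-comm 2 (a * a) ⟩
    a * a + 2              ≡⟨ eq ⟩
    (n * n + 1) * 0 + 0    ≡⟨ cong (_+ 0) (ℕ.*-zeroʳ (n * n + 1)) ⟩
    0                      ∎) λ ()
    where open ≡-Reasoning

-- Absolute values and rounding in ℤ

square-abs : ∀ a → + (∣ a ∣ ℕ.* ∣ a ∣) ≡ a ℤ.* a
square-abs (+ m)    = ℤ.pos-* m m
square-abs -[1+ m ] = refl

-- Rounding u/m to a nearest integer: the error of at most 1/2 per coordinate is what makes ℤ[√2]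
-- Euclidean.
nearest-multiple : ∀ u m → m ≢ ℤ.0ℤ → ∃[ r ] 2 ℕ.* ∣ u ℤ.- r ℤ.* m ∣ ℕ.≤ ∣ m ∣
nearest-multiple u (+ zero) m≢0 = contradiction refl m≢0
nearest-multiple u (-[1+ m ]) _ with nearest-multiple u (+ suc m) (λ ())
... | r , bound = ℤ.- r , subst (λ z → 2 ℕ.* ∣ u ℤ.- z ∣ ℕ.≤ suc m)
  (trans (cong (ℤ._* + suc m) (sym (ℤ.neg-involutive r)))
    (trans (sym (ℤ.neg-distribˡ-* (ℤ.- r) (+ suc m))) (ℤ.neg-distribʳ-* (ℤ.- r) (+ suc m)))) bound
nearest-multiple u (+ m@(suc _)) _ with u %ℕ m | n%ℕd<d u m | a≡a%ℕn+[a/ℕn]*n u m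
... | k | k<m | eq with 2 ℕ.* k ℕ.≤? m
...   | yes 2k≤m = u /ℕ m , subst (λ z → 2 ℕ.* ∣ z ∣ ℕ.≤ m) (sym (begin
          u ℤ.- (u /ℕ m) ℤ.* + m
            ≡⟨ cong (ℤ._- (u /ℕ m) ℤ.* + m) eq ⟩
          + k ℤ.+ (u /ℕ m) ℤ.* + m ℤ.- (u /ℕ m) ℤ.* + m
            ≡⟨ solve 2 (λ k t → k :+ t :- t := k) refl (+ k) ((u /ℕ m) ℤ.* + m) ⟩
          + k ∎)) 2k≤m
  where
  open ≡-Reasoning
  open ℤ-Solver
-- Here the remainder k exceeds m/2, so the next multiple is nearer, at distance o = m - k.
...   | no 2k≰m with ℕ.m≤n⇒∃[o]m+o≡n (ℕ.<⇒≤ k<m)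
...     | o , k+o≡m = u /ℕ m ℤ.+ + 1 , subst (λ z → 2 ℕ.* ∣ z ∣ ℕ.≤ m) (sym (begin
          u ℤ.- (u /ℕ m ℤ.+ + 1) ℤ.* + m
            ≡⟨ cong (ℤ._- (u /ℕ m ℤ.+ + 1) ℤ.* + m) eq ⟩
          + k ℤ.+ (u /ℕ m) ℤ.* + m ℤ.- (u /ℕ m ℤ.+ + 1) ℤ.* + m
            ≡⟨ solve 3 (λ k q m → k :+ q :* m :- (q :+ con (+ 1)) :* m := k :- m) refl (+ k) (u /ℕ m) (+ m) ⟩
          + k ℤ.- + m
            ≡⟨ cong (λ z → + k ℤ.- z) (trans (cong +_ (sym k+o≡m)) (ℤ.pos-+ k o)) ⟩
          + k ℤ.- (+ k ℤ.+ + o)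
            ≡⟨ solve 2 (λ k o → k :- (k :+ o) := :- o) refl (+ k) (+ o) ⟩
          ℤ.- + o ∎))
          (subst (λ z → 2 ℕ.* z ℕ.≤ m) (sym (ℤ.∣-i∣≡∣i∣ (+ o))) 2o≤m)
  where
  open ≡-Reasoning
  open ℤ-Solver
  2o≤m : 2 ℕ.* o ℕ.≤ m
  2o≤m = subst₂ ℕ._≤_ (cong (o ℕ.+_) (sym (ℕ.+-identityʳ o))) k+o≡m
    (ℕ.+-monoˡ-≤ o (ℕ.<⇒≤ (ℕ.+-cancelˡ-< k o k
      (subst₂ ℕ._<_ (sym k+o≡m) (cong (k ℕ.+_) (ℕ.+-identityʳ k)) (ℕ.≰⇒> 2k≰m)))))

-- Ideals of ℤ[√D] and the prime above 2

module IdealClasses (n : ℕ) (1≤n : 1 ℕ.≤ n) (D : ℕ) (D≡n²+1 : D ≡ n ℕ.* n ℕ.+ 1)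
                    (squarefree : Squarefree D) (j : ℕ) (D≡2+4j : D ≡ 2 ℕ.+ 4 ℕ.* j) where
  open QuadraticField D
  open QuadraticRing D
  open RingOfIntegers D squarefree j D≡2+4j
  open NonzeroIdeal
  open ≡-Reasoning

  -- Passage to the subtraction-free equations over ℕ of the descent: the norm is supplied as a
  -- difference f - e.
  normℤ≡⇒ℕ : ∀ a b e f → normℤ a b ≡ + f ℤ.- + e →
    ∣ a ∣ ℕ.* ∣ a ∣ ℕ.+ e ≡ (n ℕ.* n ℕ.+ 1) ℕ.* (∣ b ∣ ℕ.* ∣ b ∣) ℕ.+ f
  normℤ≡⇒ℕ a b e f eq = ℤ.+-injective (begin
    + (∣ a ∣ ℕ.* ∣ a ∣ ℕ.+ e)
      ≡⟨ trans (ℤ.pos-+ (∣ a ∣ ℕ.* ∣ a ∣) e) (cong (ℤ._+ + e) (square-abs a)) ⟩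
    a ℤ.* a ℤ.+ + e
      ≡⟨ solve 4 (λ d a b e → a :* a :+ e := (a :* a :- d :* (b :* b)) :+ d :* (b :* b) :+ e) refl (+ D) a b (+ e) ⟩
    normℤ a b ℤ.+ + D ℤ.* (b ℤ.* b) ℤ.+ + e
      ≡⟨ cong (λ z → z ℤ.+ + D ℤ.* (b ℤ.* b) ℤ.+ + e) eq ⟩
    + f ℤ.- + e ℤ.+ + D ℤ.* (b ℤ.* b) ℤ.+ + e
      ≡⟨ solve 4 (λ d b e f → f :- e :+ d :* (b :* b) :+ e := d :* (b :* b) :+ f) refl (+ D) b (+ e) (+ f) ⟩
    + D ℤ.* (b ℤ.* b) ℤ.+ + f
      ≡⟨ cong (λ z → + D ℤ.* z ℤ.+ + f) (sym (square-abs b)) ⟩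
    + D ℤ.* + (∣ b ∣ ℕ.* ∣ b ∣) ℤ.+ + f
      ≡⟨ cong (ℤ._+ + f) (sym (ℤ.pos-* D (∣ b ∣ ℕ.* ∣ b ∣))) ⟩
    + (D ℕ.* (∣ b ∣ ℕ.* ∣ b ∣)) ℤ.+ + f
      ≡⟨ sym (ℤ.pos-+ (D ℕ.* (∣ b ∣ ℕ.* ∣ b ∣)) f) ⟩
    + (D ℕ.* (∣ b ∣ ℕ.* ∣ b ∣) ℕ.+ f)
      ≡⟨ cong (λ z → + (z ℕ.* (∣ b ∣ ℕ.* ∣ b ∣) ℕ.+ f)) D≡n²+1 ⟩
    + ((n ℕ.* n ℕ.+ 1) ℕ.* (∣ b ∣ ℕ.* ∣ b ∣) ℕ.+ f) ∎)
    where open ℤ-Solver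

  normℤ≡0⇒≡0 : ∀ a b → normℤ a b ≡ ℤ.0ℤ → embed a b ≡ 0#
  normℤ≡0⇒≡0 a b eq = cong₂ embed {a} {+ 0} {b} {+ 0} (ℤ.∣i∣≡0⇒i≡0 ∣a∣≡0) (ℤ.∣i∣≡0⇒i≡0 ∣b∣≡0)
    where
    a²≡Db² : ∣ a ∣ ℕ.* ∣ a ∣ ≡ (n ℕ.* n ℕ.+ 1) ℕ.* (∣ b ∣ ℕ.* ∣ b ∣)
    a²≡Db² = ℕ.+-cancelʳ-≡ 0 _ _ (normℤ≡⇒ℕ a b 0 0 eq)
    ∣b∣≡0 : ∣ b ∣ ≡ 0
    ∣b∣≡0 = ℕ-Descent.square≡D*square⇒0 n 1≤n ∣ a ∣ ∣ b ∣ a²≡Db²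
    ∣a∣≡0 : ∣ a ∣ ≡ 0
    ∣a∣≡0 with ℕ.m*n≡0⇒m≡0∨n≡0 ∣ a ∣ (trans a²≡Db² (trans (cong (λ z → (n ℕ.* n ℕ.+ 1) ℕ.* (z ℕ.* z)) ∣b∣≡0)
                 (ℕ.*-zeroʳ (n ℕ.* n ℕ.+ 1))))
    ... | inj₁ p = p
    ... | inj₂ p = p

  0∈𝓛 : 0# ∈ 𝓛
  0∈𝓛 = ι∈𝓛 ℤ.0ℤ

  1∈𝓛 : 1# ∈ 𝓛
  1∈𝓛 = ι∈𝓛 ℤ.1ℤ

  1≢0 : 1# ≢ 0#
  1≢0 eq with cong ℚ√.rat eq
  ... | ()

  𝓞-+ : ∀ {x y} → x ∈ 𝓞 → y ∈ 𝓞 → x + y ∈ 𝓞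
  𝓞-+ {x} {y} x∈ y∈ = 𝓛⊆𝓞 {x + y} (𝓛-+ {x} {y} (𝓞⊆𝓛 x∈) (𝓞⊆𝓛 y∈))

  𝓞-* : ∀ {x y} → x ∈ 𝓞 → y ∈ 𝓞 → x * y ∈ 𝓞
  𝓞-* {x} {y} x∈ y∈ = 𝓛⊆𝓞 {x * y} (𝓛-* {x} {y} (𝓞⊆𝓛 x∈) (𝓞⊆𝓛 y∈))

  ~-refl : ∀ I → I ~ I
  ~-refl I = 1# , 1# , 𝓛⊆𝓞 1∈𝓛 , 1≢0 , 𝓛⊆𝓞 1∈𝓛 , 1≢0 , id , id

  unitIdeal : NonzeroIdeal
  unitIdeal = record
    { Member            = 𝓞
    ; integral          = id
    ; 0∈                = 𝓛⊆𝓞 0∈𝓛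
    ; +-closed          = λ {x} {y} → 𝓞-+ {x} {y}
    ; *-closed          = λ {r} {x} → 𝓞-* {r} {x}
    ; finitelyGenerated = 1# ∷ []
      , (λ {x} x∈ → x , 0# , x∈ , refl , solve 1 (λ x → x := x :* con ℤ.1ℤ :+ con ℤ.0ℤ) refl x)
      , λ { (r , _ , r∈ , refl , refl) → 𝓞-+ {r * 1#} {0#} (𝓞-* {r} {1#} r∈ (𝓛⊆𝓞 1∈𝓛)) (𝓛⊆𝓞 0∈𝓛) }
    ; nonzero           = 1# , 𝓛⊆𝓞 1∈𝓛 , 1≢0
    }
    where open K-Solver

  D≡2[1+2j] : + D ≡ + 2 ℤ.* (+ 1 ℤ.+ + 2 ℤ.* + j)
  D≡2[1+2j] = begin
    + D                                  ≡⟨ cong +_ D≡2+4j ⟩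
    + 2 ℤ.+ + (4 ℕ.* j)                  ≡⟨ cong (λ z → + 2 ℤ.+ z) (ℤ.pos-* 4 j) ⟩
    + 2 ℤ.+ + 4 ℤ.* + j                  ≡⟨ solve 1 (λ j → con (+ 2) :+ con (+ 4) :* j :=
                                            con (+ 2) :* (con (+ 1) :+ con (+ 2) :* j)) refl (+ j) ⟩
    + 2 ℤ.* (+ 1 ℤ.+ + 2 ℤ.* + j)        ∎
    where open ℤ-Solver

  -- The prime ideal (2, √D) above 2.
  𝔭 : Pred K _
  𝔭 x = ∃[ a ] ∃[ b ] x ≡ embed (+ 2 ℤ.* a) b

  𝔭⊆𝓛 : 𝔭 ⊆ 𝓛
  𝔭⊆𝓛 (a , b , eq) = + 2 ℤ.* a , b , eq

  𝔭-+ : ∀ {x y} → x ∈ 𝔭 → y ∈ 𝔭 → x + y ∈ 𝔭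
  𝔭-+ (a , b , refl) (c , d , refl) = a ℤ.+ c , b ℤ.+ d ,
    trans (embed-+ (+ 2 ℤ.* a) b (+ 2 ℤ.* c) d)
      (cong (λ z → embed z (b ℤ.+ d)) (sym (ℤ.*-distribˡ-+ (+ 2) a c)))

  -- The rational part of the product stays even because D is even.
  𝔭-* : ∀ {r x} → r ∈ 𝓛 → x ∈ 𝔭 → r * x ∈ 𝔭
  𝔭-* (c , d , refl) (a , b , refl) =
    c ℤ.* a ℤ.+ (+ 1 ℤ.+ + 2 ℤ.* + j) ℤ.* (d ℤ.* b) , c ℤ.* b ℤ.+ d ℤ.* (+ 2 ℤ.* a) ,
    trans (embed-* c d (+ 2 ℤ.* a) b) (cong (λ z → embed z (c ℤ.* b ℤ.+ d ℤ.* (+ 2 ℤ.* a))) (begin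
      c ℤ.* (+ 2 ℤ.* a) ℤ.+ + D ℤ.* (d ℤ.* b)
        ≡⟨ cong (λ z → c ℤ.* (+ 2 ℤ.* a) ℤ.+ z ℤ.* (d ℤ.* b)) D≡2[1+2j] ⟩
      c ℤ.* (+ 2 ℤ.* a) ℤ.+ (+ 2 ℤ.* (+ 1 ℤ.+ + 2 ℤ.* + j)) ℤ.* (d ℤ.* b)
        ≡⟨ solve 5 (λ a b c d j → c :* (con (+ 2) :* a) :+ (con (+ 2) :* (con (+ 1) :+ con (+ 2) :* j)) :* (d :* b) :=
             con (+ 2) :* (c :* a :+ (con (+ 1) :+ con (+ 2) :* j) :* (d :* b))) refl a b c d (+ j) ⟩
      + 2 ℤ.* (c ℤ.* a ℤ.+ (+ 1 ℤ.+ + 2 ℤ.* + j) ℤ.* (d ℤ.* b)) ∎))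
    where open ℤ-Solver

  2K √D : K
  2K = embed (+ 2) (+ 0)
  √D = embed (+ 0) (+ 1)

  2∈𝔭 : 2K ∈ 𝔭
  2∈𝔭 = + 1 , + 0 , refl

  √D∈𝔭 : √D ∈ 𝔭
  √D∈𝔭 = + 0 , + 1 , refl

  0∈𝔭 : 0# ∈ 𝔭
  0∈𝔭 = + 0 , + 0 , refl

  𝔭-generators : ∀ a b → embed (+ 2 ℤ.* a) b ≡ ι a * 2K + (ι b * √D + 0#)
  𝔭-generators a b = sym (begin
    ι a * 2K + (ι b * √D + 0#)
      ≡⟨ cong₂ (λ y z → y + (z + 0#)) (embed-* a (+ 0) (+ 2) (+ 0)) (embed-* b (+ 0) (+ 0) (+ 1)) ⟩
    _ ≡⟨ cong (λ z → embed a₁ b₁ + z) (embed-+ a₂ b₂ (+ 0) (+ 0)) ⟩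
    _ ≡⟨ embed-+ a₁ b₁ (a₂ ℤ.+ + 0) (b₂ ℤ.+ + 0) ⟩
    _ ≡⟨ cong₂ embed
         (solve 3 (λ d a b → (a :* con (+ 2) :+ d :* con (+ 0)) :+ ((b :* con (+ 0) :+ d :* con (+ 0)) :+ con (+ 0)) := con (+ 2) :* a) refl (+ D) a b)
         (solve 2 (λ a b → (a :* con (+ 0) :+ con (+ 0)) :+ ((b :* con (+ 1) :+ con (+ 0)) :+ con (+ 0)) := b) refl a b) ⟩
    embed (+ 2 ℤ.* a) b ∎)
    where
    open ℤ-Solver
    a₁ b₁ a₂ b₂ : ℤ
    a₁ = a ℤ.* + 2 ℤ.+ + D ℤ.* + 0
    b₁ = a ℤ.* + 0 ℤ.+ + 0
    a₂ = b ℤ.* + 0 ℤ.+ + D ℤ.* + 0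
    b₂ = b ℤ.* + 1 ℤ.+ + 0

  primeIdeal : NonzeroIdeal
  primeIdeal = record
    { Member            = 𝔭
    ; integral          = λ {x} x∈ → 𝓛⊆𝓞 {x} (𝔭⊆𝓛 x∈)
    ; 0∈                = 0∈𝔭
    ; +-closed          = λ {x} {y} → 𝔭-+ {x} {y}
    ; *-closed          = λ {r} {x} r∈ → 𝔭-* {r} {x} (𝓞⊆𝓛 r∈)
    ; finitelyGenerated = 2K ∷ √D ∷ []
      , (λ { (a , b , refl) → ι a , ι b * √D + 0# , 𝓛⊆𝓞 (ι∈𝓛 a)
           , (ι b , 0# , 𝓛⊆𝓞 (ι∈𝓛 b) , refl , refl) , 𝔭-generators a b })
      , λ { (r , _ , r∈ , (s , _ , s∈ , refl , refl) , refl) →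
              𝔭-+ {r * 2K} {s * √D + 0#} (𝔭-* {r} {2K} (𝓞⊆𝓛 r∈) 2∈𝔭)
                (𝔭-+ {s * √D} {0#} (𝔭-* {s} {√D} (𝓞⊆𝓛 s∈) √D∈𝔭) 0∈𝔭) }
    ; nonzero           = 2K , 2∈𝔭 , λ eq → contradiction (proj₁ (embed-injective (+ 2) (+ 0) (+ 0) (+ 0) eq)) λ ()
    }

  -- The equations give αx = αpy, so p = β/α divides x. The factor α is cancelled only after taking
  -- norms, in ℤ, where N(α) ≠ 0.
  principal-norm-divides : ∀ {α β p x y A P X Y} → A ≢ ℤ.0ℤ → norm α ≡ fromℤ A → norm p ≡ fromℤ P →
    norm x ≡ fromℤ X → norm y ≡ fromℤ Y → β * 1# ≡ α * p → α * x ≡ β * y → X ≡ P ℤ.* Y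
  principal-norm-divides {α} {β} {p} {x} {y} {A} {P} {X} {Y} A≢0 α≡A p≡P x≡X y≡Y β≡αp αx≡βy =
    ℤ.*-cancelˡ-≡ A X (P ℤ.* Y) {{ℤ.≢-nonZero A≢0}} (fromℤ-injective (A ℤ.* X) (A ℤ.* (P ℤ.* Y)) (begin
      fromℤ (A ℤ.* X)                            ≡⟨ fromℤ-* A X ⟩
      fromℤ A ℚ.* fromℤ X                        ≡⟨ cong₂ ℚ._*_ (sym α≡A) (sym x≡X) ⟩
      norm α ℚ.* norm x                          ≡⟨ sym (norm-* α x) ⟩
      norm (α * x)                               ≡⟨ cong norm (begin
          α * x               ≡⟨ αx≡βy ⟩
          β * y               ≡⟨ solve 2 (λ b y → b :* y := (b :* con ℤ.1ℤ) :* y) refl β y ⟩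
          (β * 1#) * y        ≡⟨ cong (_* y) β≡αp ⟩
          (α * p) * y         ≡⟨ solve 3 (λ a p y → (a :* p) :* y := a :* (p :* y)) refl α p y ⟩
          α * (p * y)         ∎) ⟩
      norm (α * (p * y))                         ≡⟨ trans (norm-* α (p * y)) (cong (norm α ℚ.*_) (norm-* p y)) ⟩
      norm α ℚ.* (norm p ℚ.* norm y)             ≡⟨ cong₂ ℚ._*_ α≡A (cong₂ ℚ._*_ p≡P y≡Y) ⟩
      fromℤ A ℚ.* (fromℤ P ℚ.* fromℤ Y)          ≡⟨ cong (fromℤ A ℚ.*_) (sym (fromℤ-* P Y)) ⟩
      fromℤ A ℚ.* fromℤ (P ℤ.* Y)                ≡⟨ sym (fromℤ-* A (P ℤ.* Y)) ⟩
      fromℤ (A ℤ.* (P ℤ.* Y))                    ∎))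
    where open K-Solver

  nonzero⇒normℤ≢0 : ∀ a b → embed a b ≢ 0# → normℤ a b ≢ ℤ.0ℤ
  nonzero⇒normℤ≢0 a b x≢0 eq = x≢0 (normℤ≡0⇒≡0 a b eq)

  -- A generator of (2, √D) has even norm dividing N(2) = 4 and N(√D) = −D.
  ∣norm∣≡2 : ∀ a b Y Z → normℤ (+ 2) (+ 0) ≡ normℤ (+ 2 ℤ.* a) b ℤ.* Y →
    normℤ (+ 0) (+ 1) ≡ normℤ (+ 2 ℤ.* a) b ℤ.* Z → ∣ normℤ (+ 2 ℤ.* a) b ∣ ≡ 2
  ∣norm∣≡2 a b Y Z N2≡PY N√D≡PZ = begin
    ∣ P ∣                    ≡⟨ cong ∣_∣ P≡2M ⟩
    ∣ + 2 ℤ.* M ∣            ≡⟨ ℤ.abs-* (+ 2) M ⟩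
    2 ℕ.* ∣ M ∣              ≡⟨ cong (2 ℕ.*_) (ℕ.m*n≡1⇒m≡1 ∣ M ∣ ∣ W ∣ (trans (sym (ℤ.abs-* M W)) (cong ∣_∣ MW≡1))) ⟩
    2                        ∎
    where
    open ℤ-Solver
    i h P M W : ℤ
    i = + j
    h = + 1 ℤ.+ + 2 ℤ.* i
    P = normℤ (+ 2 ℤ.* a) b
    M = + 2 ℤ.* (a ℤ.* a) ℤ.- h ℤ.* (b ℤ.* b)
    -- The combination -N(√D) - j N(2) = D - 4j is 2, so PW = 2; since P = 2M, M is a unit of ℤ.
    W = ℤ.- (Z ℤ.+ i ℤ.* Y)

    P≡2M : P ≡ + 2 ℤ.* M
    P≡2M = trans (cong (λ d → (+ 2 ℤ.* a) ℤ.* (+ 2 ℤ.* a) ℤ.- d ℤ.* (b ℤ.* b)) D≡2[1+2j])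
      (solve 3 (λ a b h → (con (+ 2) :* a) :* (con (+ 2) :* a) :- (con (+ 2) :* h) :* (b :* b) :=
        con (+ 2) :* (con (+ 2) :* (a :* a) :- h :* (b :* b))) refl a b h)

    MW≡1 : M ℤ.* W ≡ + 1
    MW≡1 = ℤ.*-cancelˡ-≡ (+ 2) (M ℤ.* W) (+ 1) (begin
      + 2 ℤ.* (M ℤ.* W)
        ≡⟨ sym (ℤ.*-assoc (+ 2) M W) ⟩
      + 2 ℤ.* M ℤ.* W
        ≡⟨ cong (ℤ._* W) (sym P≡2M) ⟩
      P ℤ.* W
        ≡⟨ solve 4 (λ p y z j → p :* (:- (z :+ j :* y)) := :- (p :* z :+ j :* (p :* y))) refl P Y Z i ⟩
      ℤ.- (P ℤ.* Z ℤ.+ i ℤ.* (P ℤ.* Y))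
        ≡⟨ cong₂ (λ s t → ℤ.- (s ℤ.+ i ℤ.* t)) (sym N√D≡PZ) (sym N2≡PY) ⟩
      ℤ.- (normℤ (+ 0) (+ 1) ℤ.+ i ℤ.* normℤ (+ 2) (+ 0))
        ≡⟨ cong (λ d → ℤ.- ((+ 0 ℤ.- d ℤ.* + 1) ℤ.+ i ℤ.* (+ 4 ℤ.- d ℤ.* + 0))) D≡2[1+2j] ⟩
      ℤ.- ((+ 0 ℤ.- (+ 2 ℤ.* h) ℤ.* + 1) ℤ.+ i ℤ.* (+ 4 ℤ.- (+ 2 ℤ.* h) ℤ.* + 0))
        ≡⟨ solve 1 (λ j →
             :- ((con (+ 0) :- (con (+ 2) :* (con (+ 1) :+ con (+ 2) :* j)) :* con (+ 1))
               :+ j :* (con (+ 4) :- (con (+ 2) :* (con (+ 1) :+ con (+ 2) :* j)) :* con (+ 0))) := con (+ 2)) refl i ⟩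
      + 2 ∎)

  -- From α𝔭 = β𝓞, the element β is αp with p in 𝔭, and p generates 𝔭. Both 2α and √D α are
  -- multiples of β, so N(p) divides N(2) and N(√D).
  generator-norm : primeIdeal ~ unitIdeal → ∃[ a ] ∃[ b ] ∣ normℤ a b ∣ ≡ 2
  generator-norm (α , β , α∈ , α≢0 , β∈ , β≢0 , α𝔭⊆β , β⊆α𝔭) =
    let a₀ , b₀ , α≡ = 𝓞⊆𝓛 {α} α∈
        p , (a , b , p≡) , β≡αp = β⊆α𝔭 {β * 1#} (1# , 𝓛⊆𝓞 {1#} 1∈𝓛 , refl)
        y , y∈ , 2α≡βy = α𝔭⊆β {α * 2K} (2K , 2∈𝔭 , refl)
        z , z∈ , √Dα≡βz = α𝔭⊆β {α * √D} (√D , √D∈𝔭 , refl)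
        Y , y≡Y = 𝓛⇒integer-norm {y} (𝓞⊆𝓛 {y} y∈)
        Z , z≡Z = 𝓛⇒integer-norm {z} (𝓞⊆𝓛 {z} z∈)
        A≢0 = nonzero⇒normℤ≢0 a₀ b₀ (λ eq → α≢0 (trans α≡ eq))
        α≡A = trans (cong norm α≡) (norm-embed a₀ b₀)
        p≡P = trans (cong norm p≡) (norm-embed (+ 2 ℤ.* a) b)
    in + 2 ℤ.* a , b , ∣norm∣≡2 a b Y Z
         (principal-norm-divides {α} {β} {p} {2K} {y} {normℤ a₀ b₀} {normℤ (+ 2 ℤ.* a) b} {normℤ (+ 2) (+ 0)} {Y}
           A≢0 α≡A p≡P (norm-embed (+ 2) (+ 0)) y≡Y β≡αp 2α≡βy)
         (principal-norm-divides {α} {β} {p} {√D} {z} {normℤ a₀ b₀} {normℤ (+ 2 ℤ.* a) b} {normℤ (+ 0) (+ 1)} {Z}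
           A≢0 α≡A p≡P (norm-embed (+ 0) (+ 1)) z≡Z β≡αp √Dα≡βz)

  normℤ≢±2 : 1 ℕ.< n → ∀ a b z → normℤ a b ≡ z → ∣ z ∣ ≢ 2
  normℤ≢±2 1<n a b (+ _)    eq refl = ℕ-Descent.norm≢2 n 1<n ∣ a ∣ ∣ b ∣ (normℤ≡⇒ℕ a b 0 2 eq)
  normℤ≢±2 1<n a b -[1+ _ ] eq refl = ℕ-Descent.norm≢-2 n 1<n ∣ a ∣ ∣ b ∣ (normℤ≡⇒ℕ a b 2 0 eq)

  primeIdeal≁unitIdeal : 1 ℕ.< n → ¬ (primeIdeal ~ unitIdeal)
  primeIdeal≁unitIdeal 1<n 𝔭~𝓞 =
    let a , b , ∣N∣≡2 = generator-norm 𝔭~𝓞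
    in normℤ≢±2 1<n a b (normℤ a b) refl ∣N∣≡2

  Principal : NonzeroIdeal → Set
  Principal I = ∃[ g ] g ∈ Member I × g ≢ 0# × (∀ {x} → x ∈ Member I → ∃[ r ] r ∈ 𝓞 × x ≡ r * g)

  -- For I = (g) and J = (k), both kI and gJ are the ideal (gk).
  principal⇒~ : ∀ {I J} → Principal I → Principal J → I ~ J
  principal⇒~ {I} {J} (g , g∈I , g≢0 , I⊆⟨g⟩) (k , k∈J , k≢0 , J⊆⟨k⟩) =
    k , g , integral J k∈J , k≢0 , integral I g∈I , g≢0
      , (λ { (x , x∈I , refl) → into J {Member I} {g} {k} k∈J I⊆⟨g⟩ {x} x∈I })
      , λ { (x , x∈J , refl) → into I {Member J} {k} {g} g∈I J⊆⟨k⟩ {x} x∈J }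
    where
    open K-Solver

    into : ∀ (J : NonzeroIdeal) {I : Pred K _} {g k} → k ∈ Member J →
           (∀ {x} → x ∈ I → ∃[ r ] r ∈ 𝓞 × x ≡ r * g) →
           ∀ {x} → x ∈ I → (g · Member J) (k * x)
    into J {g = g} {k} k∈J I⊆⟨g⟩ {x} x∈I =
      let r , r∈ , x≡rg = I⊆⟨g⟩ {x} x∈I
      in r * k , *-closed J {r} {k} r∈ k∈J , trans (cong (k *_) x≡rg)
           (solve 3 (λ g k r → k :* (r :* g) := g :* (r :* k)) refl g k r)

-- The case n = 1: ℤ[√2] is norm-Euclidean

module EuclideanDivision (squarefree : Squarefree 2) where
  open QuadraticField 2
  open QuadraticRing 2
  open RingOfIntegers 2 squarefree 0 refl
  open IdealClasses 1 ℕ.≤-refl 2 refl squarefree 0 refl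
  open NonzeroIdeal

  module _ (a b c d r s : ℤ) where
    private
      M u v ρ₁ ρ₂ : ℤ
      M = normℤ c d
      u = a ℤ.* c ℤ.- + 2 ℤ.* (b ℤ.* d) ℤ.- r ℤ.* M
      v = b ℤ.* c ℤ.- a ℤ.* d ℤ.- s ℤ.* M
      ρ₁ = a ℤ.+ (ℤ.- r ℤ.* c ℤ.+ + 2 ℤ.* (ℤ.- s ℤ.* d))
      ρ₂ = b ℤ.+ (ℤ.- r ℤ.* d ℤ.+ ℤ.- s ℤ.* c)

    -- u + v√2 is the remainder ρ₁ + ρ₂√2 times the conjugate c - d√2, so this is multiplicativity
    -- of the norm.
    remainder-norm : normℤ ρ₁ ρ₂ ℤ.* M ≡ u ℤ.* u ℤ.- + 2 ℤ.* (v ℤ.* v)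
    remainder-norm = solve 6 (λ a b c d r s →
      let M = c :* c :- con (+ 2) :* (d :* d)
          u = a :* c :- con (+ 2) :* (b :* d) :- r :* M
          v = b :* c :- a :* d :- s :* M
          ρ₁ = a :+ ((:- r) :* c :+ con (+ 2) :* ((:- s) :* d))
          ρ₂ = b :+ ((:- r) :* d :+ (:- s) :* c)
      in (ρ₁ :* ρ₁ :- con (+ 2) :* (ρ₂ :* ρ₂)) :* M := u :* u :- con (+ 2) :* (v :* v)) refl a b c d r s
      where open ℤ-Solver

    -- |u² - 2v²| ≤ u² + 2v² ≤ (1/4 + 2/4) M², hence the remainder has norm at most 3/4 of |M| in
    -- absolute value.
    remainder-norm-< : M ≢ ℤ.0ℤ → 2 ℕ.* ∣ u ∣ ℕ.≤ ∣ M ∣ → 2 ℕ.* ∣ v ∣ ℕ.≤ ∣ M ∣ → ∣ normℤ ρ₁ ρ₂ ∣ ℕ.< ∣ M ∣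
    remainder-norm-< M≢0 2u≤M 2v≤M = ℕ.*-cancelˡ-< 4 ∣ N ∣ m (ℕ.*-cancelʳ-< m (4 ℕ.* ∣ N ∣) (4 ℕ.* m) (begin-strict
      4 ℕ.* ∣ N ∣ ℕ.* m
        ≡⟨ ℕ.*-assoc 4 ∣ N ∣ m ⟩
      4 ℕ.* (∣ N ∣ ℕ.* m)
        ≡⟨ cong (4 ℕ.*_) (trans (sym (ℤ.abs-* N M)) (cong ∣_∣ remainder-norm)) ⟩
      4 ℕ.* ∣ u ℤ.* u ℤ.- + 2 ℤ.* (v ℤ.* v) ∣
        ≤⟨ ℕ.*-monoʳ-≤ 4 (ℤ.∣i-j∣≤∣i∣+∣j∣ (u ℤ.* u) (+ 2 ℤ.* (v ℤ.* v))) ⟩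
      4 ℕ.* (∣ u ℤ.* u ∣ ℕ.+ ∣ + 2 ℤ.* (v ℤ.* v) ∣)
        ≡⟨ cong (4 ℕ.*_) (cong₂ ℕ._+_ (ℤ.abs-* u u)
             (trans (ℤ.abs-* (+ 2) (v ℤ.* v)) (cong (2 ℕ.*_) (ℤ.abs-* v v)))) ⟩
      4 ℕ.* (∣ u ∣ ℕ.* ∣ u ∣ ℕ.+ 2 ℕ.* (∣ v ∣ ℕ.* ∣ v ∣))
        ≡⟨ solve 2 (λ u v → con 4 :* (u :* u :+ con 2 :* (v :* v)) :=
             (con 2 :* u) :* (con 2 :* u) :+ con 2 :* ((con 2 :* v) :* (con 2 :* v))) refl ∣ u ∣ ∣ v ∣ ⟩
      (2 ℕ.* ∣ u ∣) ℕ.* (2 ℕ.* ∣ u ∣) ℕ.+ 2 ℕ.* ((2 ℕ.* ∣ v ∣) ℕ.* (2 ℕ.* ∣ v ∣))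
        ≤⟨ ℕ.+-mono-≤ (ℕ.*-mono-≤ 2u≤M 2u≤M) (ℕ.*-monoʳ-≤ 2 (ℕ.*-mono-≤ 2v≤M 2v≤M)) ⟩
      m ℕ.* m ℕ.+ 2 ℕ.* (m ℕ.* m)
        <⟨ ℕ.m<m+n (m ℕ.* m ℕ.+ 2 ℕ.* (m ℕ.* m)) (ℕ.*-mono-≤ 1≤m 1≤m) ⟩
      m ℕ.* m ℕ.+ 2 ℕ.* (m ℕ.* m) ℕ.+ m ℕ.* m
        ≡⟨ solve 1 (λ m → m :* m :+ con 2 :* (m :* m) :+ m :* m := con 4 :* m :* m) refl m ⟩
      4 ℕ.* m ℕ.* m ∎))
      where
      open ℕ.≤-Reasoning
      open ℕ-Solver
      N = normℤ ρ₁ ρ₂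
      m = ∣ M ∣
      1≤m : 1 ℕ.≤ m
      1≤m = ℕ.n≢0⇒n>0 (λ m≡0 → M≢0 (ℤ.∣i∣≡0⇒i≡0 m≡0))

    remainder : embed a b + embed (ℤ.- r) (ℤ.- s) * embed c d ≡ embed ρ₁ ρ₂
    remainder = trans (cong (λ z → embed a b + z) (embed-* (ℤ.- r) (ℤ.- s) c d))
      (embed-+ a b (ℤ.- r ℤ.* c ℤ.+ + 2 ℤ.* (ℤ.- s ℤ.* d)) (ℤ.- r ℤ.* d ℤ.+ ℤ.- s ℤ.* c))

  -- `q` is the negative of the rounded quotient, so that the remainder x + qy lies in an ideal
  -- directly by its closure properties.
  divide : ∀ x → x ∈ 𝓛 → ∀ c d → normℤ c d ≢ ℤ.0ℤ → ∃[ q ] ∃[ ρ₁ ] ∃[ ρ₂ ]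
    q ∈ 𝓛 × x + q * embed c d ≡ embed ρ₁ ρ₂ × ∣ normℤ ρ₁ ρ₂ ∣ ℕ.< ∣ normℤ c d ∣
  divide x (a , b , x≡) c d M≢0 =
    let r , r-bound = nearest-multiple (a ℤ.* c ℤ.- + 2 ℤ.* (b ℤ.* d)) (normℤ c d) M≢0
        s , s-bound = nearest-multiple (b ℤ.* c ℤ.- a ℤ.* d) (normℤ c d) M≢0
    in embed (ℤ.- r) (ℤ.- s)
      , a ℤ.+ (ℤ.- r ℤ.* c ℤ.+ + 2 ℤ.* (ℤ.- s ℤ.* d))
      , b ℤ.+ (ℤ.- r ℤ.* d ℤ.+ ℤ.- s ℤ.* c)
      , (ℤ.- r , ℤ.- s , refl)
      , trans (cong (_+ embed (ℤ.- r) (ℤ.- s) * embed c d) x≡) (remainder a b c d r s)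
      , remainder-norm-< a b c d r s M≢0 r-bound s-bound

  -- An element of least norm generates, but membership in I is not decidable, so
  -- the search for one only yields a double negation.
  ¬¬principal : ∀ I → ¬ ¬ Principal I
  ¬¬principal I ¬principal =
    let x , x∈ , x≢0 = nonzero I
        a , b , x≡ = 𝓞⊆𝓛 {x} (integral I {x} x∈)
    -- Strong induction on the absolute norm: if all elements of smaller norm vanish, a nonzero
    -- element leaves only zero remainders and generates I. So without a generator every element is
    -- zero.
    in x≢0 (trans x≡ (<-rec Vanishing vanish _ a b refl (subst (Member I) x≡ x∈)))
    where
    Vanishing : ℕ → Set
    Vanishing k = ∀ c d → ∣ normℤ c d ∣ ≡ k → embed c d ∈ Member I → embed c d ≡ 0#

    generates : ∀ c d → embed c d ∈ Member I → embed c d ≢ 0# →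
      (∀ {l} → l ℕ.< ∣ normℤ c d ∣ → Vanishing l) →
      ∀ x → x ∈ Member I → ∃[ r ] r ∈ 𝓞 × x ≡ r * embed c d
    generates c d y∈ y≢0 smaller x x∈ =
      let q , ρ₁ , ρ₂ , q∈ , x+qy≡ρ , ρ<y =
            divide x (𝓞⊆𝓛 {x} (integral I {x} x∈)) c d (nonzero⇒normℤ≢0 c d y≢0)
          ρ∈ = subst (Member I) x+qy≡ρ (+-closed I {x} {q * y} x∈ (*-closed I {q} {y} (𝓛⊆𝓞 {q} q∈) y∈))
      in -1# * q , 𝓛⊆𝓞 { -1# * q} (𝓛-* { -1#} {q} (ι∈𝓛 (ℤ.- ℤ.1ℤ)) q∈) ,
        (begin
          x
            ≡⟨ solve 3 (λ x q y → x := (x :+ q :* y) :+ con (ℤ.- ℤ.1ℤ) :* q :* y) refl x q y ⟩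
          (x + q * y) + -1# * q * y
            ≡⟨ cong (_+ -1# * q * y) (trans x+qy≡ρ (smaller ρ<y ρ₁ ρ₂ refl ρ∈)) ⟩
          0# + -1# * q * y
            ≡⟨ solve 2 (λ q y → con ℤ.0ℤ :+ con (ℤ.- ℤ.1ℤ) :* q :* y := con (ℤ.- ℤ.1ℤ) :* q :* y) refl q y ⟩
          -1# * q * y ∎)
      where
      open K-Solver
      open ≡-Reasoning
      y -1# : K
      y = embed c d
      -1# = ι (ℤ.- ℤ.1ℤ)

    vanish : ∀ k → (∀ {l} → l ℕ.< k → Vanishing l) → Vanishing k
    -- Equality in `K` is decidable, so the element may be shown to be zero by refuting that it is
    -- nonzero.
    vanish _ smaller c d refl y∈ = decidable-stable (embed c d ≟K 0#) λ y≢0 →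
      ¬principal (embed c d , y∈ , y≢0 , λ {x} → generates c d y∈ y≢0 smaller x)

  ¬¬~ : ∀ I J → ¬ ¬ (I ~ J)
  ¬¬~ I J I≁J = ¬¬principal I λ I-principal → ¬¬principal J λ J-principal →
    I≁J (principal⇒~ {I} {J} I-principal J-principal)

-- From ideal classes to the class number

open import Data.Nat.Base using (_+_; _*_; _^_; _<_)
open import Function.Bundles using (_⇔_; mk⇔)

odd : ∀ n → ¬ (2 ∣ n) → ∃[ k ] n ≡ 1 + k * 2
odd n 2∤n with n % 2 in eq | m%n<n n 2 | m≡m%n+[m/n]*n n 2
... | 0 | _ | _  = contradiction (m%n≡0⇒n∣m n 2 eq) 2∤n
... | 1 | _ | n≡ = n / 2 , n≡
... | suc (suc _) | s≤s (s≤s ()) | _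

odd-square+1 : ∀ k → (1 + k * 2) ^ 2 + 1 ≡ 2 + 4 * (k + k * k)
odd-square+1 = solve 1 (λ k → let n = con 1 :+ k :* con 2 in
    n :* (n :* con 1) :+ con 1 := con 2 :+ con 4 :* (k :+ k :* k)) refl
  where open ℕ-Solver

n^2+1≡n*n+1 : ∀ n → n ^ 2 + 1 ≡ n * n + 1
n^2+1≡n*n+1 n = cong (λ m → n * m + 1) (ℕ.*-identityʳ n)

distinct-classes⇒1<h : ∀ {D h} → IsClassNumber D h → ∀ I J → ¬ QuadraticField._~_ D I J → 1 < h
distinct-classes⇒1<h {h = zero} (class , _) I J I≁J with class I
... | ()
distinct-classes⇒1<h {h = 1} (class , _ , injective , _) I J I≁J = contradiction (injective {I} {J} (all-equal (class I) (class J))) I≁J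
  where
  all-equal : (i j : Fin 1) → i ≡ j
  all-equal zero zero = refl
distinct-classes⇒1<h {h = suc (suc _)} _ _ _ _ = s≤s (s≤s z≤n)

-- If 1 < h, ideals over the classes 0 and 1 exist and cannot be equivalent, which contradicts even
-- a double negation. Surjectivity speaks of all ideals equivalent to the preimage; reflexivity
-- picks the preimage itself.
no-distinct-classes⇒1≮h : ∀ {D h} → IsClassNumber D h →
  (∀ I → QuadraticField._~_ D I I) → (∀ I J → ¬ ¬ QuadraticField._~_ D I J) → ¬ (1 < h)
no-distinct-classes⇒1≮h (class , congruent , _ , surjective) ~-refl ¬¬~ (s≤s (s≤s _)) =
  let I , I↦0 = surjective zero
      J , J↦1 = surjective (suc zero)
  in ¬¬~ I J λ I~J → contradiction
       (trans (sym (I↦0 {I} (~-refl I))) (trans (congruent {I} {J} I~J) (J↦1 {J} (~-refl J)))) λ ()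

corollary1p7 : (n : ℕ) → 0 < n → ¬ (2 ∣ n) → Squarefree (n ^ 2 + 1) →
    (h : ℕ) → IsClassNumber (n ^ 2 + 1) h → (1 < h ⇔ 1 < n)
corollary1p7 n 0<n 2∤n squarefree h isClassNumber = mk⇔ (to n 0<n squarefree isClassNumber) from
  where
  -- Here `n` is bound anew so that matching it with 1 computes D to 2 = 2 + 4 · 0.
  to : ∀ n → 0 < n → Squarefree (n ^ 2 + 1) → IsClassNumber (n ^ 2 + 1) h → 1 < h → 1 < n
  to 1 _ squarefree isClassNumber 1<h = contradiction 1<h
    (no-distinct-classes⇒1≮h isClassNumber
      (IdealClasses.~-refl 1 ℕ.≤-refl 2 refl squarefree 0 refl) (EuclideanDivision.¬¬~ squarefree))
  to (suc (suc _)) _ _ _ _ = s≤s (s≤s z≤n)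

  from : 1 < n → 1 < h
  from 1<n =
    let k , n≡1+2k = odd n 2∤n
        open IdealClasses n 0<n (n ^ 2 + 1) (n^2+1≡n*n+1 n) squarefree (k + k * k)
               (trans (cong (λ m → m ^ 2 + 1) n≡1+2k) (odd-square+1 k))
    in distinct-classes⇒1<h isClassNumber primeIdeal unitIdeal (primeIdeal≁unitIdeal 1<n)
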